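{- Let $G$ be a graph with vertex set $[n]$. The commutative quotient $\mathcal E_G^{ab}$ of the Fomin–Kirillov algebra $\mathcal E_G$ is isomorphic to the Orlik–Terao algebra $U_G$ (via $x_{ij}\mapsto u_{ij}$).
   Context: The Fomin–Kirillov algebra $\mathcal E_n$ is the quadratic $\mathbf Q$-algebra with generators $x_{ij}=-x_{ji}$ for distinct $i,j\in[n]$, subject to: $x_{ij}^2=0$ for distinct $i,j$; $x_{ij}x_{kl}=x_{kl}x_{ij}$ for distinct $i,j,k,l$; $x_{ij}x_{jk}+x_{jk}x_{ki}+x_{ki}x_{ij}=0$ for distinct $i,j,k$. For a graph $G$ on $[n]$, $\mathcal E_G$ is the subalgebra of $\mathcal E_n$ generated by $x_{ij}$ for edges $\overline{ij}$ of $G$, and $\mathcal E_G^{ab}$ is the quotient of $\mathcal E_G$ by the two-sided ideal generated by all commutators $ab-ba$, $a,b\in\mathcal E_G$ (equivalently by $x_{ij}x_{kl}-x_{kl}x_{ij}$ for edges of $G$). The Orlik–Terao algebra $U_G$ is the commutative $\mathbf Q$-algebra with generators $u_{ij}=-u_{ji}$ for edges $\overline{ij}$ of $G$, subject to: (1) a monomial in the $u_{ij}$ vanishes if it has a repeated variable or its support (the set of edges whose variable occurs) contains a cycle; (2) for every linear dependence $\sum_{p=1}^k c_p(e_{i_p}-e_{j_p})=0$ in $\mathbf R^n$ among vectors indexed by edges $\overline{i_pj_p}$ of $G$, the relation $\sum_{p=1}^k c_p\prod_{q\ne p}u_{i_qj_q}=0$. -}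

module Defs where

open import Algebra.Bundles using (CommutativeMonoid; Ring)
open import Algebra.Morphism.Structures using (module RingMorphisms)
open import Algebra.Structures using (IsRing)
import Algebra.Definitions.RawMonoid as RawMonoidDefinitions
import Algebra.Properties.CommutativeSemigroup as CommutativeSemigroupProperties
import Algebra.Properties.Ring as RingProperties
open import Data.Fin.Base using (Fin)
open import Data.Fin.Properties using () renaming (_≟_ to _≟ᶠ_)
open import Data.Bool.Base using (if_then_else_)
open import Data.List.Base using (_∷_; _∷ʳ_; length)
open import Data.List.Relation.Unary.Linked using (Linked)
open import Data.List.Relation.Unary.Unique.Propositional using (Unique)
open import Data.Nat.Base using (ℕ; suc; _≤_)
open import Data.Product.Base using (Σ; ∃-syntax; _×_; _,_)
open import Data.Rational.Base as ℚ using (ℚ; 0ℚ; 1ℚ)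
open import Data.Sum.Base using (_⊎_)
open import Data.Vec.Functional using (Vector; removeAt; map)
open import Function.Base using (_∘_)
open import Level using (0ℓ)
open import Relation.Binary.Core using (Rel)
open import Relation.Binary.Definitions using (Decidable; Irreflexive; Symmetric)
open import Relation.Binary.PropositionalEquality as ≡ using (_≡_; _≢_)
import Relation.Binary.Reasoning.Setoid as SetoidReasoning
open import Relation.Nullary.Decidable using (does)
open import Relation.Unary using (Pred)

-- Rings with a ring homomorphism η from ℚ to the centre; scalar
-- multiplication is a ↦ η q * a.
record ℚAlgebra : Set₁ where
  field
    ring : Ring 0ℓ 0ℓ
  open Ring ring public
  field
    η         : ℚ → Carrier
    η-homo    : RingMorphisms.IsRingHomomorphism ℚ.+-*-rawRing rawRing η
    η-central : ∀ q a → η q * a ≈ a * η q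

  open RawMonoidDefinitions +-rawMonoid public using (sum)
  open RawMonoidDefinitions *-rawMonoid public using () renaming (sum to product)

record IsℚAlgebraIsomorphism (A B : ℚAlgebra)
         (φ : ℚAlgebra.Carrier A → ℚAlgebra.Carrier B) : Set where
  private
    module A = ℚAlgebra A
    module B = ℚAlgebra B
  field
    isRingIsomorphism : RingMorphisms.IsRingIsomorphism A.rawRing B.rawRing φ
    η-preserving      : ∀ q → φ (A.η q) B.≈ B.η q

infixl 6 _⊕_
infixl 7 _⊗_

data Expr (X : Set) : Set where
  gen  : X → Expr X
  con  : ℚ → Expr X
  _⊕_  : Expr X → Expr X → Expr X
  _⊗_  : Expr X → Expr X → Expr X
  ⊝_   : Expr X → Expr X

infix 4 _∼_

data _∼_ {X : Set} : Rel (Expr X) 0ℓ where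
  ∼-refl   : ∀ {a} → a ∼ a
  ∼-sym    : ∀ {a b} → a ∼ b → b ∼ a
  ∼-trans  : ∀ {a b c} → a ∼ b → b ∼ c → a ∼ c
  ⊕-cong   : ∀ {a b c d} → a ∼ b → c ∼ d → a ⊕ c ∼ b ⊕ d
  ⊗-cong   : ∀ {a b c d} → a ∼ b → c ∼ d → a ⊗ c ∼ b ⊗ d
  ⊝-cong   : ∀ {a b} → a ∼ b → ⊝ a ∼ ⊝ b
  ⊕-assoc  : ∀ a b c → (a ⊕ b) ⊕ c ∼ a ⊕ (b ⊕ c)
  ⊕-comm   : ∀ a b → a ⊕ b ∼ b ⊕ a
  ⊕-idˡ    : ∀ a → con 0ℚ ⊕ a ∼ a
  ⊝-invˡ   : ∀ a → ⊝ a ⊕ a ∼ con 0ℚ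
  ⊗-assoc  : ∀ a b c → (a ⊗ b) ⊗ c ∼ a ⊗ (b ⊗ c)
  ⊗-idˡ    : ∀ a → con 1ℚ ⊗ a ∼ a
  ⊗-idʳ    : ∀ a → a ⊗ con 1ℚ ∼ a
  distˡ    : ∀ a b c → a ⊗ (b ⊕ c) ∼ a ⊗ b ⊕ a ⊗ c
  distʳ    : ∀ a b c → (b ⊕ c) ⊗ a ∼ b ⊗ a ⊕ c ⊗ a
  con-⊕    : ∀ p q → con (p ℚ.+ q) ∼ con p ⊕ con q
  con-⊗    : ∀ p q → con (p ℚ.* q) ∼ con p ⊗ con q
  con-⊝    : ∀ p → con (ℚ.- p) ∼ ⊝ con p
  con-comm : ∀ p a → con p ⊗ a ∼ a ⊗ con p

Free : Set → ℚAlgebra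
Free X = record
  { ring = record
    { Carrier = Expr X
    ; _≈_ = _∼_
    ; _+_ = _⊕_
    ; _*_ = _⊗_
    ; -_ = ⊝_
    ; 0# = con 0ℚ
    ; 1# = con 1ℚ
    ; isRing = record
      { +-isAbelianGroup = record
        { isGroup = record
          { isMonoid = record
            { isSemigroup = record
              { isMagma = record
                { isEquivalence = record
                  { refl = ∼-refl ; sym = ∼-sym ; trans = ∼-trans }
                ; ∙-cong = ⊕-cong }
              ; assoc = ⊕-assoc }
            ; identity = ⊕-idˡ , λ a → ∼-trans (⊕-comm _ _) (⊕-idˡ a) }
          ; inverse = ⊝-invˡ , λ a → ∼-trans (⊕-comm _ _) (⊝-invˡ a)
          ; ⁻¹-cong = ⊝-cong }
        ; comm = ⊕-comm }
      ; *-cong = ⊗-cong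
      ; *-assoc = ⊗-assoc
      ; *-identity = ⊗-idˡ , ⊗-idʳ
      ; distrib = distˡ , distʳ }
    }
  ; η = con
  ; η-homo = record
    { isSemiringHomomorphism = record
      { isNearSemiringHomomorphism = record
        { +-isMonoidHomomorphism = record
          { isMagmaHomomorphism = record
            { isRelHomomorphism = record { cong = λ { ≡.refl → ∼-refl } }
            ; homo = con-⊕ }
          ; ε-homo = ∼-refl }
        ; *-homo = con-⊗ }
      ; 1#-homo = ∼-refl }
    ; -‿homo = con-⊝ }
  ; η-central = con-comm
  }

module _ (A : ℚAlgebra) where
  open ℚAlgebra A

  data Ideal (S : Pred Carrier 0ℓ) : Pred Carrier 0ℓ where
    resp : ∀ {a b} → a ≈ b → Ideal S a → Ideal S b
    base : ∀ {a} → S a → Ideal S a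
    zer  : Ideal S 0#
    add  : ∀ {a b} → Ideal S a → Ideal S b → Ideal S (a + b)
    mulˡ : ∀ a {b} → Ideal S b → Ideal S (a * b)
    mulʳ : ∀ {a} b → Ideal S a → Ideal S (a * b)

  module _ (S : Pred Carrier 0ℓ) where
    infix 4 _≈ᵢ_

    _≈ᵢ_ : Rel Carrier 0ℓ
    a ≈ᵢ b = Ideal S (a - b)

    private
      open RingProperties ring
      open CommutativeSemigroupProperties
        (CommutativeMonoid.commutativeSemigroup +-commutativeMonoid)
        using (interchange)
      open SetoidReasoning setoid

      lift : ∀ {a b} → a ≈ b → a ≈ᵢ b
      lift {a} {b} p =
        resp (sym (trans (+-congʳ p) (-‿inverseʳ b))) zer

      neg : ∀ {a} → Ideal S a → Ideal S (- a)
      neg {a} p = resp (-1*x≈-x a) (mulˡ (- 1#) p)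

      cancel : ∀ a b c → (a - b) + (b - c) ≈ a - c
      cancel a b c = begin
        (a - b) + (b - c)       ≈⟨ +-assoc a (- b) (b - c) ⟩
        a + (- b + (b - c))     ≈⟨ +-congˡ (+-assoc (- b) b (- c)) ⟨
        a + ((- b + b) - c)     ≈⟨ +-congˡ (+-congʳ (-‿inverseˡ b)) ⟩
        a + (0# - c)            ≈⟨ +-congˡ (+-identityˡ (- c)) ⟩
        a - c                   ∎

      swap : ∀ a b → - (a - b) ≈ b - a
      swap a b = begin
        - (a - b)        ≈⟨ -‿+-comm a (- b) ⟨
        - a + - (- b)    ≈⟨ +-congˡ (-‿involutive b) ⟩
        - a + b          ≈⟨ +-comm (- a) b ⟩
        b - a            ∎

      +-congᵢ : ∀ {a b c d} → a ≈ᵢ b → c ≈ᵢ d → (a + c) ≈ᵢ (b + d)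
      +-congᵢ {a} {b} {c} {d} p q = resp eq (add p q)
        where
        eq : (a - b) + (c - d) ≈ (a + c) - (b + d)
        eq = trans (interchange a (- b) c (- d)) (+-congˡ (-‿+-comm b d))

      *-congᵢ : ∀ {a b c d} → a ≈ᵢ b → c ≈ᵢ d → (a * c) ≈ᵢ (b * d)
      *-congᵢ {a} {b} {c} {d} p q = resp eq (add (mulʳ c p) (mulˡ b q))
        where
        eq : (a - b) * c + b * (c - d) ≈ a * c - b * d
        eq = begin
          (a - b) * c + b * (c - d)
            ≈⟨ +-cong ([y-z]x≈yx-zx c a b) (x[y-z]≈xy-xz b c d) ⟩
          (a * c - b * c) + (b * c - b * d)
            ≈⟨ cancel (a * c) (b * c) (b * d) ⟩
          a * c - b * d ∎

      -‿congᵢ : ∀ {a b} → a ≈ᵢ b → (- a) ≈ᵢ (- b)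
      -‿congᵢ {a} {b} p = resp (sym (-‿+-comm a (- b))) (neg p)

      isRingᵢ : IsRing _≈ᵢ_ _+_ _*_ -_ 0# 1#
      isRingᵢ = record
        { +-isAbelianGroup = record
          { isGroup = record
            { isMonoid = record
              { isSemigroup = record
                { isMagma = record
                  { isEquivalence = record
                    { refl = lift refl
                    ; sym = λ {a} {b} p → resp (swap a b) (neg p)
                    ; trans = λ {a} {b} {c} p q → resp (cancel a b c) (add p q)
                    }
                  ; ∙-cong = +-congᵢ }
                ; assoc = λ a b c → lift (+-assoc a b c) }
              ; identity = lift ∘ +-identityˡ , lift ∘ +-identityʳ }
            ; inverse = lift ∘ -‿inverseˡ , lift ∘ -‿inverseʳ
            ; ⁻¹-cong = -‿congᵢ }
          ; comm = λ a b → lift (+-comm a b) }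
        ; *-cong = *-congᵢ
        ; *-assoc = λ a b c → lift (*-assoc a b c)
        ; *-identity = lift ∘ *-identityˡ , lift ∘ *-identityʳ
        ; distrib = (λ a b c → lift (distribˡ a b c))
                  , (λ a b c → lift (distribʳ a b c))
        }

      module ηᵢ = RingMorphisms.IsRingHomomorphism η-homo

    -- Same elements as A; equality becomes congruence modulo the ideal.
    Quotient : ℚAlgebra
    Quotient = record
      { ring = record { isRing = isRingᵢ }
      ; η = η
      ; η-homo = record
        { isSemiringHomomorphism = record
          { isNearSemiringHomomorphism = record
            { +-isMonoidHomomorphism = record
              { isMagmaHomomorphism = record
                { isRelHomomorphism = record { cong = lift ∘ ηᵢ.⟦⟧-cong }
                ; homo = λ p q → lift (ηᵢ.+-homo p q) }
              ; ε-homo = lift ηᵢ.0#-homo }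
            ; *-homo = λ p q → lift (ηᵢ.*-homo p q) }
          ; 1#-homo = lift ηᵢ.1#-homo }
        ; -‿homo = lift ∘ ηᵢ.-‿homo }
      ; η-central = λ q a → lift (η-central q a)
      }

  data Commutator : Pred Carrier 0ℓ where
    commutator : ∀ a b → Commutator (a * b - b * a)

  Abelianization : ℚAlgebra
  Abelianization = Quotient Commutator

  data Generated (S : Pred Carrier 0ℓ) : Pred Carrier 0ℓ where
    resp : ∀ {a b} → a ≈ b → Generated S a → Generated S b
    base : ∀ {a} → S a → Generated S a
    scal : ∀ q → Generated S (η q)
    add  : ∀ {a b} → Generated S a → Generated S b → Generated S (a + b)
    mul  : ∀ {a b} → Generated S a → Generated S b → Generated S (a * b)

  module _ (S : Pred Carrier 0ℓ) where
    private
      module ηₛ = RingMorphisms.IsRingHomomorphism η-homo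

      negₛ : ∀ {a} → Generated S a → Generated S (- a)
      negₛ {a} p = resp eq (mul (scal (ℚ.- 1ℚ)) p)
        where
        open SetoidReasoning setoid
        eq : η (ℚ.- 1ℚ) * a ≈ - a
        eq = begin
          η (ℚ.- 1ℚ) * a  ≈⟨ *-congʳ (ηₛ.-‿homo 1ℚ) ⟩
          - η 1ℚ * a      ≈⟨ *-congʳ (-‿cong ηₛ.1#-homo) ⟩
          - 1# * a        ≈⟨ RingProperties.-1*x≈-x ring a ⟩
          - a             ∎

    Subalgebra : ℚAlgebra
    Subalgebra = record
      { ring = record
        { Carrier = Σ Carrier (Generated S)
        ; _≈_ = λ (a , _) (b , _) → a ≈ b
        ; _+_ = λ (a , p) (b , q) → a + b , add p q
        ; _*_ = λ (a , p) (b , q) → a * b , mul p q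
        ; -_ = λ (a , p) → - a , negₛ p
        ; 0# = 0# , resp ηₛ.0#-homo (scal 0ℚ)
        ; 1# = 1# , resp ηₛ.1#-homo (scal 1ℚ)
        ; isRing = record
          { +-isAbelianGroup = record
            { isGroup = record
              { isMonoid = record
                { isSemigroup = record
                  { isMagma = record
                    { isEquivalence = record
                      { refl = refl ; sym = sym ; trans = trans }
                    ; ∙-cong = +-cong }
                  ; assoc = λ (a , _) (b , _) (c , _) → +-assoc a b c }
                ; identity = (λ (a , _) → +-identityˡ a)
                           , (λ (a , _) → +-identityʳ a) }
              ; inverse = (λ (a , _) → -‿inverseˡ a)
                        , (λ (a , _) → -‿inverseʳ a)
              ; ⁻¹-cong = -‿cong }
            ; comm = λ (a , _) (b , _) → +-comm a b }
          ; *-cong = *-cong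
          ; *-assoc = λ (a , _) (b , _) (c , _) → *-assoc a b c
          ; *-identity = (λ (a , _) → *-identityˡ a)
                       , (λ (a , _) → *-identityʳ a)
          ; distrib = (λ (a , _) (b , _) (c , _) → distribˡ a b c)
                    , (λ (a , _) (b , _) (c , _) → distribʳ a b c) }
        }
      ; η = λ q → η q , scal q
      ; η-homo = record
        { isSemiringHomomorphism = record
          { isNearSemiringHomomorphism = record
            { +-isMonoidHomomorphism = record
              { isMagmaHomomorphism = record
                { isRelHomomorphism = record { cong = ηₛ.⟦⟧-cong }
                ; homo = ηₛ.+-homo }
              ; ε-homo = ηₛ.0#-homo }
            ; *-homo = ηₛ.*-homo }
          ; 1#-homo = ηₛ.1#-homo }
        ; -‿homo = ηₛ.-‿homo }
      ; η-central = λ q (a , _) → η-central q a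
      }

record Pair (n : ℕ) : Set where
  constructor pair
  field
    src tgt   : Fin n
    .distinct : src ≢ tgt

module _ {n : ℕ} where
  open ℚAlgebra (Free (Pair n))

  private
    x : (i j : Fin n) → .(i ≢ j) → Carrier
    x i j i≢j = gen (pair i j i≢j)

  data FKRelator : Pred (Expr (Pair n)) 0ℓ where
    antisymmetry : ∀ i j (i≢j : i ≢ j) →
      FKRelator (x i j i≢j - (- x j i (≡.≢-sym i≢j)))
    square : ∀ i j (i≢j : i ≢ j) →
      FKRelator (x i j i≢j * x i j i≢j)
    commuting : ∀ i j k l (i≢j : i ≢ j) (k≢l : k ≢ l) →
      i ≢ k → i ≢ l → j ≢ k → j ≢ l →
      FKRelator (x i j i≢j * x k l k≢l - x k l k≢l * x i j i≢j)
    triangle : ∀ i j k (i≢j : i ≢ j) (j≢k : j ≢ k) (k≢i : k ≢ i) →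
      FKRelator (x i j i≢j * x j k j≢k + x j k j≢k * x k i k≢i
                 + x k i k≢i * x i j i≢j)

FominKirillov : ℕ → ℚAlgebra
FominKirillov n = Quotient (Free (Pair n)) FKRelator

record Graph (n : ℕ) : Set₁ where
  field
    Adj    : Rel (Fin n) 0ℓ
    adj?   : Decidable Adj
    symm   : Symmetric Adj
    irrefl : Irreflexive _≡_ Adj

module _ {n : ℕ} (G : Graph n) where
  open Graph G

  adj⇒≢ : ∀ {i j} → Adj i j → i ≢ j
  adj⇒≢ ij i≡j = irrefl i≡j ij

  -- Each edge occurs with both of its orientations; the field adj is
  -- irrelevant so that an oriented edge is determined by its endpoints.
  record Edge : Set where
    constructor edge
    field
      src tgt : Fin n
      .adj    : Adj src tgt

  Joins : Edge → Rel (Fin n) 0ℓ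
  Joins (edge s t _) i j = (s ≡ i × t ≡ j) ⊎ (s ≡ j × t ≡ i)

  SameEdge : Rel Edge 0ℓ
  SameEdge e (edge s t _) = Joins e s t

  data EdgeGenerator : Pred (Expr (Pair n)) 0ℓ where
    edgeGenerator : ∀ i j (ij : Adj i j) →
      EdgeGenerator (gen (pair i j (adj⇒≢ ij)))

  FKSubalgebra : ℚAlgebra
  FKSubalgebra = Subalgebra (FominKirillov n) EdgeGenerator

  FKAb : ℚAlgebra
  FKAb = Abelianization FKSubalgebra

  fk : ∀ i j → Adj i j → ℚAlgebra.Carrier FKAb
  fk i j ij = gen (pair i j (adj⇒≢ ij)) , base (edgeGenerator i j ij)

  -- u_ij and u_ji = - u_ij count as the same variable, so repetition and
  -- support are taken in terms of unoriented edges.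
  HasRepeat : ∀ {k} → Vector Edge k → Set
  HasRepeat e = ∃[ p ] ∃[ q ] p ≢ q × SameEdge (e p) (e q)

  Support : ∀ {k} → Vector Edge k → Rel (Fin n) 0ℓ
  Support e i j = ∃[ p ] Joins (e p) i j

  -- The vertices of the cycle, in order, are v ∷ vs.
  ContainsCycle : Rel (Fin n) 0ℓ → Set
  ContainsCycle R = ∃[ v ] ∃[ vs ]
    3 ≤ length (v ∷ vs) × Unique (v ∷ vs) × Linked R (v ∷ vs ∷ʳ v)

  private
    module Fr = ℚAlgebra (Free Edge)
    open RawMonoidDefinitions ℚ.+-0-rawMonoid using () renaming (sum to sumℚ)

  basis : Fin n → Vector ℚ n
  basis i v = if does (i ≟ᶠ v) then 1ℚ else 0ℚ

  edgeVector : Edge → Vector ℚ n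
  edgeVector (edge i j _) v = basis i v ℚ.- basis j v

  -- A relation of a ℚ-algebra has rational coefficients, and edge vectors
  -- are rational, so dependences in ℝⁿ enter only with c valued in ℚ.
  Dependence : ∀ {k} → Vector ℚ k → Vector Edge k → Set
  Dependence c e = ∀ v → sumℚ (λ p → c p ℚ.* edgeVector (e p) v) ≡ 0ℚ

  data OTRelator : Pred (Expr Edge) 0ℓ where
    antisymmetry : ∀ i j (ij : Adj i j) →
      OTRelator (gen (edge i j ij) Fr.- (Fr.- gen (edge j i (symm ij))))
    repeated : ∀ {k} (e : Vector Edge k) → HasRepeat e →
      OTRelator (Fr.product (map gen e))
    cyclic : ∀ {k} (e : Vector Edge k) → ContainsCycle (Support e) →
      OTRelator (Fr.product (map gen e))
    dependent : ∀ {k} (c : Vector ℚ (suc k)) (e : Vector Edge (suc k)) →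
      Dependence c e →
      OTRelator (Fr.sum λ p →
        Fr.η (c p) Fr.* Fr.product (map gen (removeAt e p)))

  -- Abelianization (Free Edge) is the polynomial algebra ℚ[u_e].
  OrlikTerao : ℚAlgebra
  OrlikTerao = Quotient (Abelianization (Free Edge)) OTRelator

  ot : ∀ i j → Adj i j → ℚAlgebra.Carrier OrlikTerao
  ot i j ij = gen (edge i j ij)

{-# OPTIONS --safe #-}
module Submission where

-- From the Orlik–Terao algebra to the Fomin–Kirillov algebra: around a cycle
-- with distinct vertices the sum over the rotations of the product omitting
-- one edge vanishes, by induction on the length using the triangle relation.
-- In a commutative quotient this yields the relation of every linear
-- dependence, since dependences are combinations of cycles, and multiplying
-- it by an edge of the cycle kills the product around the cycle.
--
-- Conversely, let a polynomial in the edge variables vanish in the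
-- Fomin–Kirillov algebra, hence in every commutative algebra with elements
-- y_ij satisfying the same relations.  Such families can be pulled back along
-- the contraction of a pair ab to the dual numbers, with y_ab = ε.  Writing the
-- polynomial as p + u q, where u is the variable of an edge ab, this shows that q
-- vanishes on the families for the contraction, so by induction q is a
-- combination of Orlik–Terao relations of the contracted graph.  A dependence
-- in the contraction lifts to a dependence involving ab once, so u times such a
-- relation is a polynomial in the other variables, and u disappears.

open import Defs
open import Algebra.Bundles using (CommutativeMonoid; CommutativeRing)
import Algebra.Definitions.RawMonoid as RawMonoidDefinitions
open import Algebra.Morphism.Structures using (module RingMorphisms)
import Algebra.Properties.CommutativeMonoid.Sum as Sum
import Algebra.Properties.CommutativeSemigroup as CommutativeSemigroupProperties
import Algebra.Properties.Ring as RingProperties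
import Algebra.Solver.Ring
open import Algebra.Solver.Ring.AlmostCommutativeRing using (_-Raw-AlmostCommutative⟶_; fromCommutativeRing)
open import Data.Bool.Base using (if_then_else_)
open import Data.Fin.Base using (Fin; zero; suc; punchOut)
open import Data.Fin.Properties using (_≟_; punchIn-punchOut)
open import Data.List.Base 
  using (List; []; _∷_; _++_; _∷ʳ_; length; map; tabulate; lookup; mapMaybe; cartesianProduct; allFin)
import Data.List.Membership.DecPropositional as DecMembership
open import Data.List.Membership.Propositional using (_∈_)
open import Data.List.Membership.Propositional.Properties
  using (∈-∃++; ∈-map⁻; ∈-cartesianProduct⁺; ∈-allFin)
import Data.List.Properties as Listₚ
open import Data.List.Relation.Binary.Permutation.Propositional using (_↭_; prep; swap; ↭-refl; ↭-trans)
open import Data.List.Relation.Binary.Permutation.Propositional.Properties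
  using (shift; ↭-length; All-resp-↭; Any-resp-↭; ++⁺ˡ)
open import Data.List.Relation.Unary.All as All using (All; []; _∷_)
import Data.List.Relation.Unary.All.Properties as Allₚ
open import Data.List.Relation.Unary.AllPairs using (AllPairs; []; _∷_)
open import Data.List.Relation.Unary.Any as Any using (Any; here; there)
import Data.List.Relation.Unary.Any.Properties as Anyₚ
open import Data.List.Relation.Unary.Linked as Linked using (Linked; []; [-]; _∷_)
open import Data.List.Relation.Unary.Unique.Propositional using (Unique)
import Data.Maybe.Base as Maybe
import Data.Maybe.Relation.Unary.Any as MaybeAny
open import Data.Nat.Base as ℕ using (ℕ; zero; suc; s≤s)
import Data.Nat.Properties as ℕₚ
open import Data.Product.Base using (Σ-syntax; ∃-syntax; _×_; _,_; proj₁; proj₂; map₂; uncurry)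
open import Data.Rational.Base as ℚ using (ℚ; 0ℚ; 1ℚ)
import Data.Rational.Properties as ℚₚ
open import Data.Rational.Solver using (module +-*-Solver)
open import Data.Sum.Base using (_⊎_; inj₁; inj₂)
open import Data.Vec.Functional using (Vector; removeAt)
open import Function.Base using (_∘_; id)
open import Level using (0ℓ)
open import Relation.Binary.Definitions using (Decidable; Symmetric)
open import Relation.Binary.PropositionalEquality as ≡ using (_≡_; _≢_)
import Relation.Binary.Reasoning.Setoid as SetoidReasoning
open import Relation.Nullary.Decidable as Dec using (Dec; does; yes; no; dec⇒maybe; recompute)
open import Relation.Nullary.Negation using (contradiction; ¬_)
open import Relation.Unary using (Pred)

-- No basis or dimension of either algebra is used: that the relations suffice is proved by deletion
-- and contraction, by induction on the number of edges. Contraction creates loops and parallel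
-- edges, so the induction ranges over multigraphs. Vanishing on all families over all commutative
-- algebras is the hypothesis that can be carried along, because it applies to the dual numbers of
-- any algebra. The choice y_ab = ε is consistent since the triangle on a, b, k acquires the ε-part
-- y_bk + y_ka, which is zero once a and b coincide. After u is eliminated, the remaining polynomial
-- still vanishes on all families, since the elimination is an identity in a universal algebra that
-- maps to every family.
--
-- In the other direction, E_G^ab divides only by commutators of elements of E_G, while the
-- induction along a cycle uses chords that may be missing from G. The cyclic relation is therefore
-- proved without commutativity inside E_n, read in E_G, and only then passed to the commutative
-- quotient. Conversely, elements of E_G are sent to U_G through expressions representing them, and
-- independence of the expression is exactly the sufficiency of the relations.

Commutative : ℚAlgebra → Set
Commutative A = ∀ a b → a * b ≈ b * a
  where open ℚAlgebra A

commutativeRing : (A : ℚAlgebra) → Commutative A → CommutativeRing 0ℓ 0ℓ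
commutativeRing A comm = record
  { isCommutativeRing = record { isRing = isRing ; *-comm = comm } }
  where open ℚAlgebra A

-- Homomorphisms, quotients and evaluation of expressions

IsHom : (A B : ℚAlgebra) → (ℚAlgebra.Carrier A → ℚAlgebra.Carrier B) → Set
IsHom A B = RingMorphisms.IsRingHomomorphism (ℚAlgebra.rawRing A) (ℚAlgebra.rawRing B)

module Hom {A B : ℚAlgebra} {f : ℚAlgebra.Carrier A → ℚAlgebra.Carrier B} (f-hom : IsHom A B f) where
  private
    module A = ℚAlgebra A
    module B = ℚAlgebra B
  open RingMorphisms.IsRingHomomorphism f-hom public

  module _ {S : Pred A.Carrier 0ℓ} (f-S : ∀ {a} → S a → f a B.≈ B.0#) where

    ideal-vanishes : ∀ {a} → Ideal A S a → f a B.≈ B.0#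
    ideal-vanishes (resp a≈b p) = B.trans (B.sym (⟦⟧-cong a≈b)) (ideal-vanishes p)
    ideal-vanishes (base s) = f-S s
    ideal-vanishes zer = 0#-homo
    ideal-vanishes (add p q) = B.trans (+-homo _ _)
      (B.trans (B.+-cong (ideal-vanishes p) (ideal-vanishes q)) (B.+-identityˡ _))
    ideal-vanishes (mulˡ a p) = B.trans (*-homo _ _)
      (B.trans (B.*-congˡ (ideal-vanishes p)) (B.zeroʳ _))
    ideal-vanishes (mulʳ b p) = B.trans (*-homo _ _)
      (B.trans (B.*-congʳ (ideal-vanishes p)) (B.zeroˡ _))

    quotient-hom : IsHom (Quotient A S) B f
    quotient-hom = record
      { isSemiringHomomorphism = record
        { isNearSemiringHomomorphism = record
          { +-isMonoidHomomorphism = record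
            { isMagmaHomomorphism = record
              { isRelHomomorphism = record { cong = f-cong }
              ; homo = +-homo }
            ; ε-homo = 0#-homo }
          ; *-homo = *-homo }
        ; 1#-homo = 1#-homo }
      ; -‿homo = -‿homo }
      where
      f-cong : ∀ {a b} → Ideal A S (a A.- b) → f a B.≈ f b
      f-cong {a} {b} p = RingProperties.x∙y⁻¹≈ε⇒x≈y B.ring (f a) (f b)
        (B.trans (B.+-congˡ (B.sym (-‿homo b)))
          (B.trans (B.sym (+-homo a (A.- b))) (ideal-vanishes p)))

module _ (A : ℚAlgebra) {S : Pred (ℚAlgebra.Carrier A) 0ℓ} where
  open ℚAlgebra A

  ≈⇒≈ᵢ : ∀ {a b} → a ≈ b → _≈ᵢ_ A S a b
  ≈⇒≈ᵢ {a} {b} a≈b = resp (sym (trans (+-congʳ a≈b) (-‿inverseʳ b))) zer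

  ideal⇒≈0 : ∀ {a} → Ideal A S a → ℚAlgebra._≈_ (Quotient A S) a 0#
  ideal⇒≈0 {a} p = resp (sym (trans (+-congˡ (RingProperties.-0#≈0# ring)) (+-identityʳ a))) p

  ≈0⇒ideal : ∀ {a} → ℚAlgebra._≈_ (Quotient A S) a 0# → Ideal A S a
  ≈0⇒ideal {a} p = resp (trans (+-congˡ (RingProperties.-0#≈0# ring)) (+-identityʳ a)) p

abelianization-commutative : (A : ℚAlgebra) → Commutative (Abelianization A)
abelianization-commutative A a b = base (commutator a b)

quotient-commutative : {A : ℚAlgebra} {S : Pred (ℚAlgebra.Carrier A) 0ℓ} →
  Commutative A → Commutative (Quotient A S)
quotient-commutative {A} comm a b = ≈⇒≈ᵢ A (comm a b)

module _ (A : ℚAlgebra) {X : Set} (ρ : X → ℚAlgebra.Carrier A) where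
  open ℚAlgebra A
  private
    module η = RingMorphisms.IsRingHomomorphism η-homo

  eval : Expr X → Carrier
  eval (gen x) = ρ x
  eval (con q) = η q
  eval (a ⊕ b) = eval a + eval b
  eval (a ⊗ b) = eval a * eval b
  eval (⊝ a) = - eval a

  eval-cong : ∀ {a b} → a ∼ b → eval a ≈ eval b
  eval-cong ∼-refl = refl
  eval-cong (∼-sym p) = sym (eval-cong p)
  eval-cong (∼-trans p q) = trans (eval-cong p) (eval-cong q)
  eval-cong (⊕-cong p q) = +-cong (eval-cong p) (eval-cong q)
  eval-cong (⊗-cong p q) = *-cong (eval-cong p) (eval-cong q)
  eval-cong (⊝-cong p) = -‿cong (eval-cong p)
  eval-cong (⊕-assoc a b c) = +-assoc _ _ _
  eval-cong (⊕-comm a b) = +-comm _ _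
  eval-cong (⊕-idˡ a) = trans (+-congʳ η.0#-homo) (+-identityˡ _)
  eval-cong (⊝-invˡ a) = trans (-‿inverseˡ _) (sym η.0#-homo)
  eval-cong (⊗-assoc a b c) = *-assoc _ _ _
  eval-cong (⊗-idˡ a) = trans (*-congʳ η.1#-homo) (*-identityˡ _)
  eval-cong (⊗-idʳ a) = trans (*-congˡ η.1#-homo) (*-identityʳ _)
  eval-cong (distˡ a b c) = distribˡ _ _ _
  eval-cong (distʳ a b c) = distribʳ _ _ _
  eval-cong (con-⊕ p q) = η.+-homo p q
  eval-cong (con-⊗ p q) = η.*-homo p q
  eval-cong (con-⊝ p) = η.-‿homo p
  eval-cong (con-comm p a) = η-central p _

  eval-hom : IsHom (Free X) A eval
  eval-hom = record
    { isSemiringHomomorphism = record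
      { isNearSemiringHomomorphism = record
        { +-isMonoidHomomorphism = record
          { isMagmaHomomorphism = record
            { isRelHomomorphism = record { cong = eval-cong }
            ; homo = λ _ _ → refl }
          ; ε-homo = η.0#-homo }
        ; *-homo = λ _ _ → refl }
      ; 1#-homo = η.1#-homo }
    ; -‿homo = λ _ → refl }

  module _ (comm : Commutative A) where

    abelian-eval-hom : IsHom (Abelianization (Free X)) A eval
    abelian-eval-hom = Hom.quotient-hom {Free X} {A} eval-hom λ where
      (commutator a b) → trans (+-congʳ (comm (eval a) (eval b))) (-‿inverseʳ _)

eval-gen : ∀ {X} (a : Expr X) → eval (Free X) gen a ≡ a
eval-gen (gen x) = ≡.refl
eval-gen (con q) = ≡.refl
eval-gen (a ⊕ b) = ≡.cong₂ _⊕_ (eval-gen a) (eval-gen b)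
eval-gen (a ⊗ b) = ≡.cong₂ _⊗_ (eval-gen a) (eval-gen b)
eval-gen (⊝ a) = ≡.cong ⊝_ (eval-gen a)

-- Dual numbers a + ε a′ with ε central and ε² = 0.
Dual : ℚAlgebra → ℚAlgebra
Dual A = record
  { ring = record
    { Carrier = Carrier × Carrier
    ; _≈_ = λ (a , a′) (b , b′) → a ≈ b × a′ ≈ b′
    ; _+_ = λ (a , a′) (b , b′) → a + b , a′ + b′
    ; _*_ = λ (a , a′) (b , b′) → a * b , a * b′ + a′ * b
    ; -_ = λ (a , a′) → - a , - a′
    ; 0# = 0# , 0#
    ; 1# = 1# , 0#
    ; isRing = record
      { +-isAbelianGroup = record
        { isGroup = record
          { isMonoid = record
            { isSemigroup = record
              { isMagma = record
                { isEquivalence = record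
                  { refl = refl , refl
                  ; sym = λ (p , q) → sym p , sym q
                  ; trans = λ (p , q) (r , s) → trans p r , trans q s }
                ; ∙-cong = λ (p , q) (r , s) → +-cong p r , +-cong q s }
              ; assoc = λ _ _ _ → +-assoc _ _ _ , +-assoc _ _ _ }
            ; identity = (λ _ → +-identityˡ _ , +-identityˡ _)
                       , (λ _ → +-identityʳ _ , +-identityʳ _) }
          ; inverse = (λ _ → -‿inverseˡ _ , -‿inverseˡ _)
                    , (λ _ → -‿inverseʳ _ , -‿inverseʳ _)
          ; ⁻¹-cong = λ (p , q) → -‿cong p , -‿cong q }
        ; comm = λ _ _ → +-comm _ _ , +-comm _ _ }
      ; *-cong = λ (p , q) (r , s) → *-cong p r , +-cong (*-cong p s) (*-cong q r)
      ; *-assoc = λ (a , a′) (b , b′) (c , c′) → *-assoc a b c , (begin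
          (a * b) * c′ + (a * b′ + a′ * b) * c
            ≈⟨ +-cong (*-assoc a b c′) (trans (distribʳ c _ _) (+-cong (*-assoc a b′ c) (*-assoc a′ b c))) ⟩
          a * (b * c′) + (a * (b′ * c) + a′ * (b * c))
            ≈⟨ +-assoc _ _ _ ⟨
          (a * (b * c′) + a * (b′ * c)) + a′ * (b * c)
            ≈⟨ +-congʳ (distribˡ a _ _) ⟨
          a * (b * c′ + b′ * c) + a′ * (b * c) ∎)
      ; *-identity = (λ (a , a′) → *-identityˡ a , trans (+-cong (*-identityˡ a′) (zeroˡ a)) (+-identityʳ a′))
                   , (λ (a , a′) → *-identityʳ a , trans (+-cong (zeroʳ a) (*-identityʳ a′)) (+-identityˡ a′))
      ; distrib = (λ (a , a′) (b , b′) (c , c′) → distribˡ a b c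
                    , trans (+-cong (distribˡ a b′ c′) (distribˡ a′ b c)) (interchange _ _ _ _))
                , (λ (a , a′) (b , b′) (c , c′) → distribʳ a b c
                    , trans (+-cong (distribʳ a′ b c) (distribʳ a b′ c′)) (interchange _ _ _ _))
      }
    }
  ; η = λ q → η q , 0#
  ; η-homo = record
    { isSemiringHomomorphism = record
      { isNearSemiringHomomorphism = record
        { +-isMonoidHomomorphism = record
          { isMagmaHomomorphism = record
            { isRelHomomorphism = record { cong = λ p → η.⟦⟧-cong p , refl }
            ; homo = λ p q → η.+-homo p q , sym (+-identityˡ 0#) }
          ; ε-homo = η.0#-homo , refl }
        ; *-homo = λ p q → η.*-homo p q , sym (trans (+-cong (zeroʳ _) (zeroˡ _)) (+-identityˡ 0#)) }
      ; 1#-homo = η.1#-homo , refl }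
    ; -‿homo = λ p → η.-‿homo p , sym (RingProperties.-0#≈0# ring) }
  ; η-central = λ q (a , a′) → η-central q a
      , trans (+-cong (η-central q a′) (zeroˡ a)) (trans (+-comm _ _) (+-cong (sym (zeroʳ a)) refl))
  }
  where
  open ℚAlgebra A
  open SetoidReasoning setoid
  open CommutativeSemigroupProperties
    (CommutativeMonoid.commutativeSemigroup +-commutativeMonoid) using (interchange)
  module η = RingMorphisms.IsRingHomomorphism η-homo

dual-commutative : ∀ {A} → Commutative A → Commutative (Dual A)
dual-commutative {A} comm (a , a′) (b , b′) =
  comm a b , trans (+-comm _ _) (+-cong (comm a′ b) (comm a b′))
  where open ℚAlgebra A

rationals : ℚAlgebra
rationals = record
  { ring = CommutativeRing.ring ℚₚ.+-*-commutativeRing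
  ; η = λ q → q
  ; η-homo = record
    { isSemiringHomomorphism = record
      { isNearSemiringHomomorphism = record
        { +-isMonoidHomomorphism = record
          { isMagmaHomomorphism = record
            { isRelHomomorphism = record { cong = λ p → p }
            ; homo = λ _ _ → ≡.refl }
          ; ε-homo = ≡.refl }
        ; *-homo = λ _ _ → ≡.refl }
      ; 1#-homo = ≡.refl }
    ; -‿homo = λ _ → ≡.refl }
  ; η-central = ℚₚ.*-comm
  }

module AlgebraSolver (A : ℚAlgebra) (comm : Commutative A) where
  open ℚAlgebra A
  private
    module η = RingMorphisms.IsRingHomomorphism η-homo

    -- Agrees with η, but makes the solver read con 0ℚ and con 1ℚ as 0# and 1#.
    scalar : ℚ → Carrier
    scalar q = if does (q ℚₚ.≟ 0ℚ) then 0# else if does (q ℚₚ.≟ 1ℚ) then 1# else η q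

    scalar≈η : ∀ q → scalar q ≈ η q
    scalar≈η q with q ℚₚ.≟ 0ℚ
    ... | yes ≡.refl = sym η.0#-homo
    ... | no _ with q ℚₚ.≟ 1ℚ
    ...   | yes ≡.refl = sym η.1#-homo
    ...   | no _ = refl

    scalars : ℚ.+-*-rawRing -Raw-AlmostCommutative⟶ fromCommutativeRing (commutativeRing A comm)
    scalars = record
      { ⟦_⟧ = scalar
      ; +-homo = λ p q → trans (scalar≈η _) (trans (η.+-homo p q) (sym (+-cong (scalar≈η p) (scalar≈η q))))
      ; *-homo = λ p q → trans (scalar≈η _) (trans (η.*-homo p q) (sym (*-cong (scalar≈η p) (scalar≈η q))))
      ; -‿homo = λ p → trans (scalar≈η _) (trans (η.-‿homo p) (sym (-‿cong (scalar≈η p))))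
      ; 0-homo = refl
      ; 1-homo = refl
      }

    weaklyEqual : ∀ p q → Maybe.Maybe (scalar p ≈ scalar q)
    weaklyEqual p q = Maybe.map (λ { ≡.refl → refl }) (dec⇒maybe (p ℚₚ.≟ q))

  open Algebra.Solver.Ring ℚ.+-*-rawRing (fromCommutativeRing (commutativeRing A comm))
    scalars weaklyEqual public using (solve; _:=_; _:+_; _:*_; _:-_; :-_; con)

open AllPairs using ([]; _∷_)

-- Dependences and cycles

module _ {n : ℕ} where

  δ : Fin n → Fin n → ℚ
  δ i v = if does (i ≟ v) then 1ℚ else 0ℚ

  δ-refl : ∀ i → δ i i ≡ 1ℚ
  δ-refl i with i ≟ i
  ... | yes _ = ≡.refl
  ... | no i≢i = contradiction ≡.refl i≢i

  δ-≢ : ∀ {i v} → i ≢ v → δ i v ≡ 0ℚ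
  δ-≢ {i} {v} i≢v with i ≟ v
  ... | yes i≡v = contradiction i≡v i≢v
  ... | no _ = ≡.refl

  vec : Fin n × Fin n → Fin n → ℚ
  vec (i , j) v = δ i v ℚ.- δ j v

  module _ {X : Set} (ends : X → Fin n × Fin n) where

    boundary : List (ℚ × X) → Fin n → ℚ
    boundary [] v = 0ℚ
    boundary ((c , x) ∷ l) v = c ℚ.* vec (ends x) v ℚ.+ boundary l v

    boundary-++ : ∀ l l′ v → boundary (l ++ l′) v ≡ boundary l v ℚ.+ boundary l′ v
    boundary-++ [] l′ v = ≡.sym (ℚₚ.+-identityˡ _)
    boundary-++ ((c , x) ∷ l) l′ v =
      ≡.trans (≡.cong (c ℚ.* vec (ends x) v ℚ.+_) (boundary-++ l l′ v))
        (≡.sym (ℚₚ.+-assoc (c ℚ.* vec (ends x) v) (boundary l v) (boundary l′ v)))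

    boundary-↭ : ∀ {l l′} → l ↭ l′ → ∀ v → boundary l v ≡ boundary l′ v
    boundary-↭ _↭_.refl v = ≡.refl
    boundary-↭ (prep (c , x) p) v = ≡.cong (c ℚ.* vec (ends x) v ℚ.+_) (boundary-↭ p v)
    boundary-↭ {x ∷ y ∷ l} {y ∷ x ∷ l′} (swap _ _ p) v =
      ≡.trans (≡.cong (λ s → a ℚ.+ (b ℚ.+ s)) (boundary-↭ p v))
        (solve 3 (λ a b s → a :+ (b :+ s) := b :+ (a :+ s)) ≡.refl a b (boundary l′ v))
      where
      open +-*-Solver
      a b : ℚ
      a = proj₁ x ℚ.* vec (ends (proj₂ x)) v
      b = proj₁ y ℚ.* vec (ends (proj₂ y)) v
    boundary-↭ (_↭_.trans p q) v = ≡.trans (boundary-↭ p v) (boundary-↭ q v)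

  boundary-map : ∀ {X Y : Set} (f : X → Y) (ends : Y → Fin n × Fin n) l v →
    boundary ends (map (map₂ f) l) v ≡ boundary (ends ∘ f) l v
  boundary-map f ends [] v = ≡.refl
  boundary-map f ends ((c , x) ∷ l) v = ≡.cong (c ℚ.* vec (ends (f x)) v ℚ.+_) (boundary-map f ends l v)

module _ (A : ℚAlgebra) {X : Set} (ρ : X → ℚAlgebra.Carrier A) where
  open ℚAlgebra A

  ∏ : List (ℚ × X) → Carrier
  ∏ [] = 1#
  ∏ ((_ , x) ∷ l) = ρ x * ∏ l

  -- Σ_p c_p ∏_{q ≠ p} ρ x_q
  ∂∏ : List (ℚ × X) → Carrier
  ∂∏ [] = 0#
  ∂∏ ((c , x) ∷ l) = η c * ∏ l + ρ x * ∂∏ l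

ones : ∀ {X : Set} → List (ℚ × X) → List (ℚ × X)
ones = map (λ (_ , x) → 1ℚ , x)

lower : ∀ {X : Set} → ℚ → List (ℚ × X) → List (ℚ × X)
lower γ = map (λ (c , x) → c ℚ.- γ , x)

module _ (A : ℚAlgebra) (comm : Commutative A) {X : Set} (ρ : X → ℚAlgebra.Carrier A) where
  open ℚAlgebra A
  open SetoidReasoning setoid
  open AlgebraSolver A comm
  private
    module η = RingMorphisms.IsRingHomomorphism η-homo
    P = ∏ A ρ
    R = ∂∏ A ρ

  ∏-++ : ∀ l l′ → P (l ++ l′) ≈ P l * P l′
  ∏-++ [] l′ = sym (*-identityˡ _)
  ∏-++ (_ ∷ l) l′ = trans (*-congˡ (∏-++ l l′)) (sym (*-assoc _ _ _))

  ∏-↭ : ∀ {l l′} → l ↭ l′ → P l ≈ P l′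
  ∏-↭ _↭_.refl = refl
  ∏-↭ (prep _ p) = *-congˡ (∏-↭ p)
  ∏-↭ (swap (_ , x) (_ , y) p) = trans (*-congˡ (*-congˡ (∏-↭ p)))
    (solve 3 (λ a b c → a :* (b :* c) := b :* (a :* c)) refl (ρ x) (ρ y) _)
  ∏-↭ (_↭_.trans p q) = trans (∏-↭ p) (∏-↭ q)

  ∂∏-↭ : ∀ {l l′} → l ↭ l′ → R l ≈ R l′
  ∂∏-↭ _↭_.refl = refl
  ∂∏-↭ (prep _ p) = +-cong (*-congˡ (∏-↭ p)) (*-congˡ (∂∏-↭ p))
  ∂∏-↭ (swap (c , x) (d , y) p) = trans
    (+-cong (*-congˡ (*-congˡ (∏-↭ p))) (*-congˡ (+-cong (*-congˡ (∏-↭ p)) (*-congˡ (∂∏-↭ p)))))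
    (solve 6 (λ c d x y p r → c :* (y :* p) :+ x :* (d :* p :+ y :* r)
                           := d :* (x :* p) :+ y :* (c :* p :+ x :* r)) refl
      (η c) (η d) (ρ x) (ρ y) _ _)
  ∂∏-↭ (_↭_.trans p q) = trans (∂∏-↭ p) (∂∏-↭ q)

  ∏-lower : ∀ γ l l′ → P (lower γ l ++ l′) ≈ P l * P l′
  ∏-lower γ [] l′ = sym (*-identityˡ _)
  ∏-lower γ (_ ∷ l) l′ = trans (*-congˡ (∏-lower γ l l′)) (sym (*-assoc _ _ _))

  ∏-ones : ∀ l → P (ones l) ≈ P l
  ∏-ones [] = refl
  ∏-ones (_ ∷ l) = *-congˡ (∏-ones l)

  -- The coefficients enter `∂∏` linearly and the products not at all. Subtracting γ throughout `l`
  -- thus removes γ times the all-ones `∂∏` of `l`, multiplied by the product of `l′`.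
  ∂∏-lower : ∀ γ l l′ → R (l ++ l′) ≈ R (lower γ l ++ l′) + η γ * (R (ones l) * P l′)
  ∂∏-lower γ [] l′ = solve 3 (λ r p g → r := r :+ g :* (con 0ℚ :* p)) refl _ _ _
  ∂∏-lower γ ((c , x) ∷ l) l′ = begin
    η c * P (l ++ l′) + ρ x * R (l ++ l′)
      ≈⟨ +-cong (*-congˡ (∏-++ l l′)) (*-congˡ (∂∏-lower γ l l′)) ⟩
    η c * (P l * P l′) + ρ x * (R (lower γ l ++ l′) + η γ * (R (ones l) * P l′))
      ≈⟨ solve 7 (λ c g p p′ x r s → c :* (p :* p′) :+ x :* (r :+ g :* (s :* p′))
           := ((c :- g) :* (p :* p′) :+ x :* r) :+ g :* ((con 1ℚ :* p :+ x :* s) :* p′)) refl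
           (η c) (η γ) (P l) (P l′) (ρ x) _ _ ⟩
    ((η c - η γ) * (P l * P l′) + ρ x * R (lower γ l ++ l′)) + η γ * ((1# * P l + ρ x * R (ones l)) * P l′)
      ≈⟨ +-cong (+-congʳ (*-cong (trans (η.+-homo c (ℚ.- γ)) (+-congˡ (η.-‿homo γ))) (∏-lower γ l l′)))
           (*-congˡ (*-congʳ (+-congʳ (*-cong η.1#-homo (∏-ones l))))) ⟨
    (η (c ℚ.- γ) * P (lower γ l ++ l′) + ρ x * R (lower γ l ++ l′))
      + η γ * ((η 1ℚ * P (ones l) + ρ x * R (ones l)) * P l′) ∎

-- A path is a start vertex together with its further vertices, each carrying
-- the coefficient of the step that leads to it.
module _ {n : ℕ} where

  steps : Fin n → List (ℚ × Fin n) → List (ℚ × (Fin n × Fin n))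
  steps h [] = []
  steps h ((c , w) ∷ ws) = (c , h , w) ∷ steps w ws

  last : Fin n → List (Fin n) → Fin n
  last h [] = h
  last h (w ∷ ws) = last w ws

  steps-++ : ∀ h xs ys → steps h (xs ++ ys) ≡ steps h xs ++ steps (last h (map proj₂ xs)) ys
  steps-++ h [] ys = ≡.refl
  steps-++ h ((c , w) ∷ xs) ys = ≡.cong ((c , h , w) ∷_) (steps-++ w xs ys)

  boundary-steps : ∀ h xs v → boundary id (ones (steps h xs)) v ≡ δ h v ℚ.- δ (last h (map proj₂ xs)) v
  boundary-steps h [] v = ≡.sym (ℚₚ.+-inverseʳ (δ h v))
  boundary-steps h ((_ , w) ∷ xs) v = ≡.trans
    (≡.cong (1ℚ ℚ.* vec (h , w) v ℚ.+_) (boundary-steps w xs v))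
    (solve 3 (λ a b c → con 1ℚ :* (a :- b) :+ (b :- c) := a :- c) ≡.refl (δ h v) (δ w v) _)
    where open +-*-Solver

  -- For a path that starts at `h` and goes on to `w`, this leaves the first step as the only
  -- contribution to the boundary at `h`.
  boundary-fresh : ∀ h w xs → All (h ≢_) (w ∷ map proj₂ xs) → boundary id (steps w xs) h ≡ 0ℚ
  boundary-fresh h w [] _ = ≡.refl
  boundary-fresh h w ((c , u) ∷ xs) (h≢w ∷ h≢u ∷ fr) = begin
    c ℚ.* (δ w h ℚ.- δ u h) ℚ.+ boundary id (steps u xs) h
      ≡⟨ ≡.cong₂ (λ p q → c ℚ.* p ℚ.+ q) (≡.cong₂ ℚ._-_ (δ-≢ (≡.≢-sym h≢w)) (δ-≢ (≡.≢-sym h≢u)))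
           (boundary-fresh h u xs (h≢u ∷ fr)) ⟩
    c ℚ.* 0ℚ ℚ.+ 0ℚ  ≡⟨ ≡.trans (ℚₚ.+-identityʳ _) (ℚₚ.*-zeroʳ c) ⟩
    0ℚ ∎
    where open ≡.≡-Reasoning

  boundary-lower : ∀ γ (l l′ : List (ℚ × (Fin n × Fin n))) v → boundary id (l ++ l′) v
    ≡ boundary id (lower γ l ++ l′) v ℚ.+ γ ℚ.* boundary id (ones l) v
  boundary-lower γ [] l′ v = ≡.sym (≡.trans (≡.cong (boundary id l′ v ℚ.+_) (ℚₚ.*-zeroʳ γ)) (ℚₚ.+-identityʳ _))
  boundary-lower γ ((c , x) ∷ l) l′ v = ≡.trans (≡.cong (c ℚ.* vec x v ℚ.+_) (boundary-lower γ l l′ v))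
    (solve 5 (λ c g x b o → c :* x :+ (b :+ g :* o)
       := ((c :- g) :* x :+ b) :+ g :* (con 1ℚ :* x :+ o)) ≡.refl c γ (vec x v) _ _)
    where open +-*-Solver

  incident-term : ∀ h (l : List (ℚ × (Fin n × Fin n))) → boundary id l h ≢ 0ℚ →
    ∃[ c ] ∃[ i ] ∃[ j ] ∃[ l′ ] l ↭ (c , i , j) ∷ l′ × c ≢ 0ℚ × (i ≡ h ⊎ j ≡ h)
  incident-term h [] b≢0 = contradiction ≡.refl b≢0
  incident-term h ((c , i , j) ∷ l) b≢0 with c ℚ.* vec (i , j) h ℚₚ.≟ 0ℚ
  ... | yes eq =
    let d , i′ , j′ , l′ , p , rest = incident-term h l
          (λ b≡0 → b≢0 (≡.trans (≡.cong₂ ℚ._+_ eq b≡0) (ℚₚ.+-identityˡ 0ℚ)))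
    in d , i′ , j′ , (c , i , j) ∷ l′ , ↭-trans (prep _ p) (swap _ _ ↭-refl) , rest
  ... | no c*v≢0 = c , i , j , l , ↭-refl , (λ { ≡.refl → c*v≢0 (ℚₚ.*-zeroˡ (vec (i , j) h)) }) , incident
    where
    incident : i ≡ h ⊎ j ≡ h
    incident with Dec.toSum (i ≟ h) | Dec.toSum (j ≟ h)
    ... | inj₁ p | _ = inj₁ p
    ... | inj₂ _ | inj₁ q = inj₂ q
    ... | inj₂ p | inj₂ q = contradiction
      (≡.trans (≡.cong (c ℚ.*_) (≡.cong₂ ℚ._-_ (δ-≢ p) (δ-≢ q))) (ℚₚ.*-zeroʳ c)) c*v≢0

open AllPairs using ([]; _∷_)

module _ {n : ℕ} where

  last-∷ʳ : ∀ (h : Fin n) xs (c : ℚ) u → last h (map proj₂ (xs ∷ʳ (c , u))) ≡ u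
  last-∷ʳ h [] c u = ≡.refl
  last-∷ʳ h ((_ , w) ∷ xs) c u = last-∷ʳ w xs c u

  linked-steps : {E : Fin n → Fin n → Set} → ∀ h ws →
    All (λ (_ , i , j) → E i j) (steps h ws) → Linked E (h ∷ map proj₂ ws)
  linked-steps h [] _ = [-]
  linked-steps h ((_ , w) ∷ ws) (hw ∷ es) = hw ∷ linked-steps w ws es

module CycleSpace {n : ℕ} (A : ℚAlgebra) (comm : Commutative A)
  (y : Fin n → Fin n → ℚAlgebra.Carrier A) (E : Fin n → Fin n → Set) where
  open ℚAlgebra A
  open SetoidReasoning setoid
  open DecMembership (_≟_ {n}) using (_∈?_)

  private
    module η = RingMorphisms.IsRingHomomorphism η-homo
    Step = ℚ × Fin n × Fin n
    P R : List Step → Carrier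
    P = ∏ A (uncurry y)
    R = ∂∏ A (uncurry y)
    ∂ : List Step → Fin n → ℚ
    ∂ = boundary id
    AllE : List Step → Set
    AllE = All (λ (_ , i , j) → E i j)

  -- The left side is `∂∏` of the closed path with all coefficients 1, expanded at its closing step.
  CyclicRelation : Set
  CyclicRelation = ∀ h ws → Unique (h ∷ map proj₂ ws) → Linked E (h ∷ map proj₂ ws) →
    E (last h (map proj₂ ws)) h →
    P (steps h ws) + y (last h (map proj₂ ws)) h * R (ones (steps h ws)) ≈ 0#

  module _
    (E-sym : ∀ {i j} → E i j → E j i)
    (E-irrefl : ∀ {i j} → E i j → i ≢ j)
    (antisym : ∀ {i j} → E i j → y j i ≈ - y i j)
    (cyclic : CyclicRelation) where

    Vanishes : List Step → Set
    Vanishes L = AllE L → (∀ v → ∂ L v ≡ 0ℚ) → R L ≈ 0#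

    -- Reversing a step and negating its coefficient keeps the boundary and changes only the sign of
    -- `∂∏`.
    flip-vanishes : ∀ {c i j L} → Vanishes ((ℚ.- c , j , i) ∷ L) → Vanishes ((c , i , j) ∷ L)
    flip-vanishes {c} {i} {j} {L} vanishes (ij ∷ es) ∂≡0 = begin
      η c * P L + y i j * R L
        ≈⟨ solve 4 (λ c p y r → c :* p :+ y :* r := :- (:- c :* p :+ :- y :* r)) refl (η c) (P L) (y i j) (R L) ⟩
      - (- η c * P L + - y i j * R L)
        ≈⟨ -‿cong (+-cong (*-congʳ (η.-‿homo c)) (*-congʳ (antisym ij))) ⟨
      - (η (ℚ.- c) * P L + y j i * R L)
        ≈⟨ -‿cong (vanishes (E-sym ij ∷ es) λ v → ≡.trans (flip-boundary v) (∂≡0 v)) ⟩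
      - 0#
        ≈⟨ RingProperties.-0#≈0# ring ⟩
      0# ∎
      where
      open AlgebraSolver A comm
      flip-boundary : ∀ v → ∂ ((ℚ.- c , j , i) ∷ L) v ≡ ∂ ((c , i , j) ∷ L) v
      flip-boundary v = solve′ 4 (λ c a b r → ⊖ c ⊛ (b ⊝′ a) ⊞ r ⊜ c ⊛ (a ⊝′ b) ⊞ r) ≡.refl c (δ i v) (δ j v) (∂ L v)
        where open +-*-Solver renaming (solve to solve′; _:*_ to _⊛_; _:+_ to _⊞_; _:-_ to _⊝′_; :-_ to ⊖_; _:=_ to _⊜_)

    zero-vanishes : ∀ {x L} → Vanishes L → Vanishes ((0ℚ , x) ∷ L)
    zero-vanishes {x} {L} vanishes (_ ∷ es) ∂≡0 = begin
      η 0ℚ * P L + uncurry y x * R L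
        ≈⟨ +-cong (trans (*-congʳ η.0#-homo) (zeroˡ _)) (trans (*-congˡ (vanishes es ∂L≡0)) (zeroʳ _)) ⟩
      0# + 0#  ≈⟨ +-identityˡ 0# ⟩
      0# ∎
      where
      ∂L≡0 : ∀ v → ∂ L v ≡ 0ℚ
      ∂L≡0 v = ≡.trans (≡.sym (≡.trans (≡.cong (ℚ._+ ∂ L v) (ℚₚ.*-zeroˡ (vec x v))) (ℚₚ.+-identityˡ _))) (∂≡0 v)

    -- Subtracting γ times the closed path from u through C back to u
    -- annihilates the coefficient of its first step.
    cycle-vanishes : ∀ {γ u h ws Y} → let C = steps h ws in
      Unique (h ∷ map proj₂ ws) → last h (map proj₂ ws) ≡ u →
      Vanishes (lower γ C ++ Y) → Vanishes ((γ , u , h) ∷ C ++ Y)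
    cycle-vanishes {γ} {u} {h} {ws} {Y} uniq ≡.refl vanishes (uh ∷ es) ∂≡0 = begin
      R (C⁺ ++ Y)
        ≈⟨ ∂∏-lower A comm (uncurry y) γ C⁺ Y ⟩
      R (lower γ C⁺ ++ Y) + η γ * (R (ones C⁺) * P Y)
        ≈⟨ +-cong lowered (*-congˡ (*-congʳ closed)) ⟩
      0# + η γ * (0# * P Y)
        ≈⟨ solve 2 (λ g p → con 0ℚ :+ g :* (con 0ℚ :* p) := con 0ℚ) refl _ _ ⟩
      0# ∎
      where
      open AlgebraSolver A comm
      C C⁺ : List Step
      C = steps h ws
      C⁺ = (γ , u , h) ∷ C
      closed : R (ones C⁺) ≈ 0#
      closed = trans (+-congʳ (trans (*-congʳ η.1#-homo) (trans (*-identityˡ _) (∏-ones A comm (uncurry y) C))))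
        (cyclic h ws uniq (linked-steps h ws (Allₚ.++⁻ˡ C es)) uh)
      allE : AllE (lower γ C ++ Y)
      allE = Allₚ.++⁺ (Allₚ.map⁺ (Allₚ.++⁻ˡ C es)) (Allₚ.++⁻ʳ C es)
      ∂-lowered : ∀ v → ∂ (lower γ C⁺ ++ Y) v ≡ 0ℚ
      ∂-lowered v = ℚ′.begin
        ∂ (lower γ C⁺ ++ Y) v  ℚ′.≡⟨ ℚₚ.+-identityʳ _ ⟨
        ∂ (lower γ C⁺ ++ Y) v ℚ.+ 0ℚ  ℚ′.≡⟨ ≡.cong (∂ (lower γ C⁺ ++ Y) v ℚ.+_) ones≡0 ⟨
        ∂ (lower γ C⁺ ++ Y) v ℚ.+ γ ℚ.* ∂ (ones C⁺) v  ℚ′.≡⟨ boundary-lower γ C⁺ Y v ⟨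
        ∂ (C⁺ ++ Y) v  ℚ′.≡⟨ ∂≡0 v ⟩
        0ℚ ℚ′.∎
        where
        module ℚ′ = ≡.≡-Reasoning
        ones≡0 : γ ℚ.* ∂ (ones C⁺) v ≡ 0ℚ
        ones≡0 = ≡.trans
          (≡.cong (λ s → γ ℚ.* (1ℚ ℚ.* vec (u , h) v ℚ.+ s)) (boundary-steps h ws v))
          (solve′ 3 (λ g a b → g ⊛ (con′ 1ℚ ⊛ (a ⊝′ b) ⊞ (b ⊝′ a)) ⊜ con′ 0ℚ) ≡.refl γ (δ u v) (δ h v))
          where open +-*-Solver renaming (solve to solve′; _:*_ to _⊛_; _:+_ to _⊞_; _:-_ to _⊝′_; con to con′; _:=_ to _⊜_)
      lowered : R (lower γ C⁺ ++ Y) ≈ 0#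
      lowered = ≡.subst (λ c → AllE ((c , u , h) ∷ lower γ C ++ Y) → (∀ v → ∂ ((c , u , h) ∷ lower γ C ++ Y) v ≡ 0ℚ) →
          R ((c , u , h) ∷ lower γ C ++ Y) ≈ 0#) (≡.sym (ℚₚ.+-inverseʳ γ))
        (zero-vanishes vanishes) (uh ∷ allE) ∂-lowered

    -- The steps of a path form the beginning of the list; the path grows at h
    -- by steps from the rest until it closes up.
    grow : ∀ k → (∀ L → length L ≡ k → Vanishes L) →
      ∀ r rest → length rest ≡ r → ∀ h c w ws → c ≢ 0ℚ → Unique (h ∷ w ∷ map proj₂ ws) →
      length (steps h ((c , w) ∷ ws) ++ rest) ≡ suc k →
      Vanishes (steps h ((c , w) ∷ ws) ++ rest)
    grow k IH r rest r≡ h c w ws c≢0 uniq@((h∉) ∷ _) len es ∂≡0 =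
      let d , i , j , rest′ , p , d≢0 , inc = incident-term h rest ∂rest≢0
      in go r r≡ d i j rest′ p d≢0 inc
      where
      path = steps h ((c , w) ∷ ws)
      h≢w : h ≢ w
      h≢w = All.head h∉
      -- The path leaves `h` once and never returns, so its own boundary at `h` is `c`. The total is
      -- zero, hence the remaining terms must contribute `- c` and one of them meets `h`.
      ∂rest≢0 : ∂ rest h ≢ 0ℚ
      ∂rest≢0 eq = c≢0 (≡.trans (≡.sym (≡.trans
          (≡.cong₂ ℚ._+_ (≡.cong₂ ℚ._+_ (≡.cong (c ℚ.*_) (≡.cong₂ ℚ._-_ (δ-refl h) (δ-≢ (≡.≢-sym h≢w))))
              (boundary-fresh h w ws h∉)) eq)
          (solve 1 (λ c → c :* (con 1ℚ :- con 0ℚ) :+ con 0ℚ :+ con 0ℚ := c) ≡.refl c)))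
        (≡.trans (≡.sym (boundary-++ id path rest h)) (∂≡0 h)))
        where open +-*-Solver
      extend : ∀ r rest′ → length rest′ ≡ r → ∀ d u → d ≢ 0ℚ → length (path ++ rest′) ≡ k →
        Vanishes ((d , u , h) ∷ path ++ rest′)
      extend r rest′ r≡ d u d≢0 len′ es′ ∂≡0′ with u ∈? h ∷ w ∷ map proj₂ ws
      ... | no u∉ = grow k IH r rest′ r≡ u d h ((c , w) ∷ ws) d≢0
                      (Allₚ.¬Any⇒All¬ _ u∉ ∷ uniq) (≡.cong suc len′) es′ ∂≡0′
      ... | yes (here ≡.refl) = contradiction ≡.refl (E-irrefl (All.head es′))
      ... | yes (there u∈) with ∈-map⁻ proj₂ {xs = (c , w) ∷ ws} u∈
      ...   | (b , _) , bu∈ , ≡.refl with ∈-∃++ bu∈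
      -- The path up to `u` and the new step form a cycle. Subtracting it turns the coefficient of
      -- the new step into zero; without that step `k` terms are left, which is the length that `IH`
      -- covers.
      ...     | xs , zs , eq = ≡.subst (λ l → Vanishes ((d , u , h) ∷ l)) (≡.sym split)
                  (cycle-vanishes uniq-xs (last-∷ʳ h xs b u)
                    (IH _ (≡.trans len-lower (≡.trans (≡.sym (≡.cong length split)) len′))))
                  es′ ∂≡0′
        where
        xs⁺ = xs ∷ʳ (b , u)
        Y = steps (last h (map proj₂ xs⁺)) zs ++ rest′
        eq⁺ : (c , w) ∷ ws ≡ xs⁺ ++ zs
        eq⁺ = ≡.trans eq (≡.sym (Listₚ.++-assoc xs _ zs))
        split : path ++ rest′ ≡ steps h xs⁺ ++ Y
        split = ≡.trans (≡.cong (_++ rest′) (≡.trans (≡.cong (steps h) eq⁺) (steps-++ h xs⁺ zs)))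
          (Listₚ.++-assoc (steps h xs⁺) _ rest′)
        len-lower : length (lower d (steps h xs⁺) ++ Y) ≡ length (steps h xs⁺ ++ Y)
        len-lower = ≡.trans (Listₚ.length-++ (lower d (steps h xs⁺)))
          (≡.trans (≡.cong (ℕ._+ length Y) (Listₚ.length-map _ (steps h xs⁺))) (≡.sym (Listₚ.length-++ (steps h xs⁺))))
        uniq-xs : Unique (h ∷ map proj₂ xs⁺)
        uniq-xs = proj₁ (AllPairs++⁻ (h ∷ map proj₂ xs⁺) (≡.subst (λ l → Unique (h ∷ l))
          (≡.trans (≡.cong (map proj₂) eq⁺) (Listₚ.map-++ proj₂ xs⁺ zs)) uniq))
          where
          AllPairs++⁻ : ∀ (xs : List (Fin n)) {ys} → Unique (xs ++ ys) → Unique xs × Unique ys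
          AllPairs++⁻ [] u = [] , u
          AllPairs++⁻ (x ∷ xs) (px ∷ u) = let a , b = AllPairs++⁻ xs u in Allₚ.++⁻ˡ xs px ∷ a , b
      go : ∀ r → length rest ≡ r → ∀ d i j rest′ →
        rest ↭ (d , i , j) ∷ rest′ → d ≢ 0ℚ → i ≡ h ⊎ j ≡ h → R (path ++ rest) ≈ 0#
      go zero r≡ d i j rest′ p _ _ = contradiction (≡.trans (≡.sym (↭-length p)) r≡) λ ()
      go (suc r) r≡ d i j rest′ p d≢0 inc = trans (∂∏-↭ A comm (uncurry y) perm)
        (oriented inc (All-resp-↭ perm es) (λ v → ≡.trans (≡.sym (boundary-↭ id perm v)) (∂≡0 v)))
        where
        perm : path ++ rest ↭ (d , i , j) ∷ path ++ rest′
        perm = ↭-trans (++⁺ˡ path p) (shift _ path rest′)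
        r≡′ : length rest′ ≡ r
        r≡′ = ℕₚ.suc-injective (≡.trans (≡.sym (↭-length p)) r≡)
        len′ : length (path ++ rest′) ≡ k
        len′ = ℕₚ.suc-injective (≡.trans (≡.sym (↭-length perm)) len)
        oriented : i ≡ h ⊎ j ≡ h → Vanishes ((d , i , j) ∷ path ++ rest′)
        oriented (inj₂ ≡.refl) = extend r rest′ r≡′ d i d≢0 len′
        oriented (inj₁ ≡.refl) = flip-vanishes (extend r rest′ r≡′ (ℚ.- d) j
          (λ -d≡0 → d≢0 (ℚₚ.neg-injective -d≡0)) len′)

    -- Induction on the number of terms: a zero coefficient splits off its factor, and a nonzero one
    -- starts a path which must eventually close up and lose a step.
    dependence-length : ∀ k L → length L ≡ k → Vanishes L
    dependence-length k [] _ _ _ = refl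
    dependence-length (suc k) ((c , i , j) ∷ L) len with c ℚₚ.≟ 0ℚ
    ... | yes ≡.refl = zero-vanishes (dependence-length k L (ℕₚ.suc-injective len))
    ... | no c≢0 = λ es → grow k (dependence-length k) _ L ≡.refl i c j [] c≢0
            ((E-irrefl (All.head es) ∷ []) ∷ [] ∷ []) len es

    dependence : ∀ L → Vanishes L
    dependence L = dependence-length _ L ≡.refl

-- Fomin–Kirillov families

record FKFamily (A : ℚAlgebra) {n : ℕ} (y : Fin n → Fin n → ℚAlgebra.Carrier A) : Set where
  open ℚAlgebra A
  field
    diagonal  : ∀ i → y i i ≈ 0#
    antisym   : ∀ i j → y j i ≈ - y i j
    nilpotent : ∀ i j → y i j * y i j ≈ 0#
    commute   : ∀ {i j k l} → i ≢ k → i ≢ l → j ≢ k → j ≢ l → y i j * y k l ≈ y k l * y i j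
    cyclic₃   : ∀ i j k → y i j * y j k + y j k * y k i + y k i * y i j ≈ 0#

module _ (A : ℚAlgebra) {n : ℕ} (y : Fin n → Fin n → ℚAlgebra.Carrier A) where
  open ℚAlgebra A

  walk : Fin n → List (Fin n) → Carrier
  walk h [] = 1#
  walk h (w ∷ ws) = y h w * walk w ws

  -- The sum over the steps of the walk of
  -- (product of the later steps) * z * (product of the earlier steps).
  cut : Carrier → Fin n → List (Fin n) → Carrier
  cut z h [] = 0#
  cut z h (w ∷ ws) = walk w ws * z + cut (z * y h w) w ws

  cut-cong : ∀ {z z′} h ws → z ≈ z′ → cut z h ws ≈ cut z′ h ws
  cut-cong h [] p = refl
  cut-cong h (w ∷ ws) p = +-cong (*-congˡ p) (cut-cong w ws (*-congʳ p))

  cut-+ : ∀ z z′ h ws → cut (z + z′) h ws ≈ cut z h ws + cut z′ h ws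
  cut-+ z z′ h [] = sym (+-identityˡ 0#)
  cut-+ z z′ h (w ∷ ws) = trans
    (+-cong (distribˡ _ z z′) (trans (cut-cong w ws (distribʳ _ z z′)) (cut-+ _ _ w ws)))
    (interchange _ _ _ _)
    where
    open CommutativeSemigroupProperties
      (CommutativeMonoid.commutativeSemigroup +-commutativeMonoid) using (interchange)

module _ {n : ℕ} where

  last-fresh : ∀ {u : Fin n} w ws → All (u ≢_) (w ∷ ws) → u ≢ last w ws
  last-fresh w [] (p ∷ _) = p
  last-fresh w (w′ ∷ ws) (_ ∷ ps) = last-fresh w′ ws ps

module CyclicRelations {A : ℚAlgebra} {n : ℕ} {y : Fin n → Fin n → ℚAlgebra.Carrier A}
  (fk : FKFamily A y) where
  open ℚAlgebra A
  open FKFamily fk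
  open SetoidReasoning setoid
  open RingProperties ring

  private
    Q = walk A y
    N = cut A y

  module _ {g : Carrier} {F : Pred (Fin n) 0ℓ} (commutes : ∀ {i j} → F i → F j → g * y i j ≈ y i j * g) where

    walk-commutes : ∀ h ws → F h → All F ws → Q h ws * g ≈ g * Q h ws
    walk-commutes h [] _ _ = trans (*-identityˡ g) (sym (*-identityʳ g))
    walk-commutes h (w ∷ ws) Fh (Fw ∷ Fws) = begin
      (y h w * Q w ws) * g  ≈⟨ *-assoc _ _ _ ⟩
      y h w * (Q w ws * g)  ≈⟨ *-congˡ (walk-commutes w ws Fw Fws) ⟩
      y h w * (g * Q w ws)  ≈⟨ *-assoc _ _ _ ⟨
      (y h w * g) * Q w ws  ≈⟨ *-congʳ (commutes Fh Fw) ⟨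
      (g * y h w) * Q w ws  ≈⟨ *-assoc _ _ _ ⟩
      g * (y h w * Q w ws)  ∎

    -- Only the steps after a cut stand to the left of `g`, and these run between vertices of `ws`.
    -- The start `h` is therefore exempt from `F`.
    cut-*ˡ : ∀ z h ws → All F ws → N (g * z) h ws ≈ g * N z h ws
    cut-*ˡ z h [] _ = sym (zeroʳ g)
    cut-*ˡ z h (w ∷ ws) (Fw ∷ Fws) = begin
      Q w ws * (g * z) + N (g * z * y h w) w ws
        ≈⟨ +-cong (sym (*-assoc _ g z)) (trans (cut-cong A y w ws (*-assoc g z _)) (cut-*ˡ (z * y h w) w ws Fws)) ⟩
      (Q w ws * g) * z + g * N (z * y h w) w ws
        ≈⟨ +-congʳ (trans (*-congʳ (walk-commutes w ws Fw Fws)) (*-assoc g _ z)) ⟩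
      g * (Q w ws * z) + g * N (z * y h w) w ws
        ≈⟨ distribˡ g _ _ ⟨
      g * (Q w ws * z + N (z * y h w) w ws) ∎

  -- Every step before a cut avoids the last vertex.
  cut-*ʳ : ∀ z {l v} h ws → Unique (h ∷ ws) → last h ws ≡ l → All (v ≢_) (h ∷ ws) →
    N (z * y l v) h ws ≈ N z h ws * y l v
  cut-*ʳ z h [] _ _ _ = sym (zeroˡ _)
  cut-*ʳ z {l} {v} h (w ∷ ws) (h∉ ∷ uniq) ≡.refl (v≢h ∷ v∉) = begin
    Q w ws * (z * y l v) + N (z * y l v * y h w) w ws
      ≈⟨ +-cong (sym (*-assoc _ z _)) (rest ws ≡.refl) ⟩
    (Q w ws * z) * y l v + N (z * y h w) w ws * y l v
      ≈⟨ distribʳ _ _ _ ⟨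
    (Q w ws * z + N (z * y h w) w ws) * y l v ∎
    where
    rest : ∀ ws′ → ws′ ≡ ws → N (z * y l v * y h w) w ws ≈ N (z * y h w) w ws * y l v
    -- This case must be separate: here `w` is the last vertex, so `y h w` and `y l v` share it and
    -- need not commute. No cut remains, however, and both sides are zero.
    rest [] ≡.refl = sym (zeroˡ _)
    rest (w′ ∷ ws′) ≡.refl = begin
      N (z * y l v * y h w) w ws
        ≈⟨ cut-cong A y w ws (trans (*-assoc z _ _) (trans (*-congˡ
             (commute (≡.≢-sym (last-fresh w ws h∉)) (≡.≢-sym (last-fresh w′ ws′ (uniq-head uniq))) v≢h (All.head v∉)))
             (sym (*-assoc z _ _)))) ⟩
      N (z * y h w * y l v) w ws
        ≈⟨ cut-*ʳ (z * y h w) w ws uniq ≡.refl v∉ ⟩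
      N (z * y h w) w ws * y l v ∎
      where
      uniq-head : ∀ {x xs} → Unique (x ∷ xs) → All (x ≢_) xs
      uniq-head (p ∷ _) = p

  -- Removing the first vertex v from the cycle by the triangle on the last
  -- vertex, v and w shortens the cycle.
  cyclic-relation : ∀ v w ws → Unique (v ∷ w ∷ ws) → N (y (last w ws) v) v (w ∷ ws) ≈ - Q v (w ∷ ws)
  cyclic-relation v w [] _ = begin
    1# * y w v + 0#  ≈⟨ trans (+-identityʳ _) (*-identityˡ _) ⟩
    y w v            ≈⟨ antisym v w ⟩
    - y v w          ≈⟨ -‿cong (*-identityʳ _) ⟨
    - (y v w * 1#)   ∎
  cyclic-relation v w ws@(w′ ∷ ws′) ((v≢w ∷ v∉) ∷ uniq@(w∉ ∷ _)) = begin
    Q w ws * y l v + N (y l v * y v w) w ws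
      ≈⟨ +-congˡ (cut-cong A y w ws rotate) ⟩
    Q w ws * y l v + N (y v w * y l w + y l w * y l v) w ws
      ≈⟨ +-congˡ (cut-+ A y _ _ w ws) ⟩
    Q w ws * y l v + (N (y v w * y l w) w ws + N (y l w * y l v) w ws)
      ≈⟨ +-congˡ (+-cong
           (cut-*ˡ {F = λ i → v ≢ i × w ≢ i} (λ (a , b) (c , d) → commute a c b d) (y l w) w ws (All.zip (v∉ , w∉)))
           (cut-*ʳ (y l w) w ws uniq ≡.refl (v≢w ∷ v∉))) ⟩
    Q w ws * y l v + (y v w * N (y l w) w ws + N (y l w) w ws * y l v)
      ≈⟨ +-congˡ (+-cong (*-congˡ IH) (*-congʳ IH)) ⟩
    Q w ws * y l v + (y v w * - Q w ws + - Q w ws * y l v)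
      ≈⟨ +-congˡ (+-cong (-‿distribʳ-* _ _) (-‿distribˡ-* _ _)) ⟨
    Q w ws * y l v + (- (y v w * Q w ws) + - (Q w ws * y l v))
      ≈⟨ trans (sym (+-assoc _ _ _)) (xyx⁻¹≈y (Q w ws * y l v) (- (y v w * Q w ws))) ⟩
    - (y v w * Q w ws) ∎
    where
    l = last w ws
    IH : N (y l w) w ws ≈ - Q w ws
    IH = cyclic-relation w w′ ws′ uniq
    rotate : y l v * y v w ≈ y v w * y l w + y l w * y l v
    rotate = begin
      y l v * y v w
        ≈⟨ +-inverseˡ-unique _ _ (trans (sym (+-assoc _ _ _)) (cyclic₃ l v w)) ⟩
      - (y v w * y w l + y w l * y l v)
        ≈⟨ -‿+-comm _ _ ⟨
      - (y v w * y w l) + - (y w l * y l v)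
        ≈⟨ +-cong (-‿distribʳ-* _ _) (-‿distribˡ-* _ _) ⟩
      y v w * - y w l + - y w l * y l v
        ≈⟨ +-cong (*-congˡ (antisym w l)) (*-congʳ (antisym w l)) ⟨
      y v w * y l w + y l w * y l v ∎

module _ (A : ℚAlgebra) (comm : Commutative A) {n : ℕ} (y : Fin n → Fin n → ℚAlgebra.Carrier A) where
  open ℚAlgebra A
  private
    module η = RingMorphisms.IsRingHomomorphism η-homo

  walk≈∏ : ∀ h ws → walk A y h (map proj₂ ws) ≈ ∏ A (uncurry y) (steps h ws)
  walk≈∏ h [] = refl
  walk≈∏ h ((_ , w) ∷ ws) = *-congˡ (walk≈∏ w ws)

  -- With commuting factors, each cut is `z` times the product that omits one step, and together
  -- these form the all-ones `∂∏`.
  cut≈∂∏ : ∀ z h ws → cut A y z h (map proj₂ ws) ≈ z * ∂∏ A (uncurry y) (ones (steps h ws))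
  cut≈∂∏ z h [] = sym (zeroʳ z)
  cut≈∂∏ z h ((_ , w) ∷ ws) = trans
    (+-cong (*-congʳ (trans (walk≈∏ w ws) (sym (∏-ones A comm (uncurry y) (steps w ws))))) (cut≈∂∏ (z * y h w) w ws))
    (trans (solve 4 (λ p z a r → p :* z :+ z :* a :* r := z :* (con 1ℚ :* p :+ a :* r)) refl _ z _ _)
      (*-congˡ (+-congʳ (*-congʳ (sym η.1#-homo)))))
    where open AlgebraSolver A comm

  cut⇒CyclicRelation : (E : Fin n → Fin n → Set) → (∀ {i j} → E i j → i ≢ j) →
    (∀ v w ws → Unique (v ∷ w ∷ ws) → Linked E (v ∷ w ∷ ws) → E (last w ws) v →
      walk A y v (w ∷ ws) + cut A y (y (last w ws) v) v (w ∷ ws) ≈ 0#) →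
    CycleSpace.CyclicRelation A comm y E
  cut⇒CyclicRelation E E-irrefl rel h [] _ _ hh = contradiction ≡.refl (E-irrefl hh)
  cut⇒CyclicRelation E E-irrefl rel h ws@((_ , w) ∷ ws′) uniq linked closing = trans
    (+-cong (sym (walk≈∏ h ws)) (sym (cut≈∂∏ _ h ws)))
    (rel h w (map proj₂ ws′) uniq linked closing)

module _ {A : ℚAlgebra} {n : ℕ} {y : Fin n → Fin n → ℚAlgebra.Carrier A} (fk : FKFamily A y) where
  open ℚAlgebra A
  open FKFamily fk

  cyclic-zero : ∀ v w ws → Unique (v ∷ w ∷ ws) → walk A y v (w ∷ ws) + cut A y (y (last w ws) v) v (w ∷ ws) ≈ 0#
  cyclic-zero v w ws uniq = trans (+-congˡ (CyclicRelations.cyclic-relation fk v w ws uniq)) (-‿inverseʳ _)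

  fk-dependence : (comm : Commutative A) → ∀ L → All (λ (_ , i , j) → i ≢ j) L →
    (∀ v → boundary id L v ≡ 0ℚ) → ∂∏ A (uncurry y) L ≈ 0#
  fk-dependence comm = CycleSpace.dependence A comm y _≢_ ≡.≢-sym id (λ _ → antisym _ _)
    (cut⇒CyclicRelation A comm y _≢_ id λ v w ws uniq _ _ → cyclic-zero v w ws uniq)

-- Contraction

module Contraction {n : ℕ} (a b : Fin n) (a≢b : a ≢ b) where

  -- The contraction keeps the vertex set `Fin n`; `b` merely becomes isolated. The induction on
  -- edges can thus keep `n` fixed.
  merge : Fin n → Fin n
  merge i = if does (i ≟ b) then a else i

  merge² : Fin n × Fin n → Fin n × Fin n
  merge² (i , j) = merge i , merge j

  -- A two-by-two determinant of Kronecker deltas: 1 at (a, b), -1 at (b, a) and 0 elsewhere. In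
  -- this form antisymmetry and vanishing on the diagonal are polynomial identities.
  orientation : Fin n → Fin n → ℚ
  orientation i j = δ i a ℚ.* δ j b ℚ.- δ i b ℚ.* δ j a

  data Merged : Fin n → Fin n → Set where
    equal    : ∀ {i} → Merged i i
    parallel : Merged a b
    opposite : Merged b a

  merged : ∀ i j → merge i ≡ merge j → Merged i j
  merged i j eq with i ≟ b | j ≟ b
  merged i j eq | yes ≡.refl | yes ≡.refl = equal
  merged i j ≡.refl | yes ≡.refl | no _ = opposite
  merged i j ≡.refl | no _ | yes ≡.refl = parallel
  merged i j ≡.refl | no _ | no _ = equal

  orientation-equal : ∀ i → orientation i i ≡ 0ℚ
  orientation-equal i = solve 2 (λ p q → p :* q :- q :* p := con 0ℚ) ≡.refl (δ i a) (δ i b)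
    where open +-*-Solver

  orientation-parallel : orientation a b ≡ 1ℚ
  orientation-parallel = ≡.cong₂ ℚ._-_ (≡.cong₂ ℚ._*_ (δ-refl a) (δ-refl b)) (≡.cong₂ ℚ._*_ (δ-≢ a≢b) (δ-≢ (≡.≢-sym a≢b)))

  orientation-opposite : orientation b a ≡ ℚ.- 1ℚ
  orientation-opposite = ≡.cong₂ ℚ._-_ (≡.cong₂ ℚ._*_ (δ-≢ (≡.≢-sym a≢b)) (δ-≢ a≢b)) (≡.cong₂ ℚ._*_ (δ-refl b) (δ-refl a))

  merge-a : merge a ≡ a
  merge-a with a ≟ b
  ... | yes _ = ≡.refl
  ... | no _ = ≡.refl

  merge-b : merge b ≡ a
  merge-b with b ≟ b
  ... | yes _ = ≡.refl
  ... | no b≢b = contradiction ≡.refl b≢b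

  orientation-distinct : ∀ i j → merge i ≢ merge j → orientation i j ≡ 0ℚ
  orientation-distinct i j m≢ = ≡.trans (≡.cong₂ ℚ._-_ (product-zero i j (ab i j m≢)) (product-zero′ i j m≢)) ≡.refl
    where
    ab : ∀ i j → merge i ≢ merge j → i ≢ a ⊎ j ≢ b
    ab i j m≢ with i ≟ a
    ... | no i≢a = inj₁ i≢a
    ... | yes ≡.refl = inj₂ λ { ≡.refl → m≢ (≡.trans merge-a (≡.sym merge-b)) }
    product-zero : ∀ i j → i ≢ a ⊎ j ≢ b → δ i a ℚ.* δ j b ≡ 0ℚ
    product-zero i j (inj₁ i≢a) = ≡.trans (≡.cong (ℚ._* δ j b) (δ-≢ i≢a)) (ℚₚ.*-zeroˡ (δ j b))
    product-zero i j (inj₂ j≢b) = ≡.trans (≡.cong (δ i a ℚ.*_) (δ-≢ j≢b)) (ℚₚ.*-zeroʳ (δ i a))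
    product-zero′ : ∀ i j → merge i ≢ merge j → δ i b ℚ.* δ j a ≡ 0ℚ
    product-zero′ i j m≢ = ≡.trans (ℚₚ.*-comm (δ i b) (δ j a)) (product-zero j i (ab j i (≡.≢-sym m≢)))

  δ-merge-a : ∀ i → δ (merge i) a ≡ δ i a ℚ.+ δ i b
  δ-merge-a i with i ≟ b
  ... | yes ≡.refl = ≡.trans (δ-refl a) (≡.cong (ℚ._+ 1ℚ) (≡.sym (δ-≢ (≡.≢-sym a≢b))))
  ... | no i≢b = ≡.sym (ℚₚ.+-identityʳ (δ i a))

  δ-merge : ∀ i {v} → a ≢ v → b ≢ v → δ (merge i) v ≡ δ i v
  δ-merge i a≢v b≢v with i ≟ b
  ... | yes ≡.refl = ≡.trans (δ-≢ a≢v) (≡.sym (δ-≢ b≢v))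
  ... | no _ = ≡.refl

  module _ {X : Set} (ends : X → Fin n × Fin n) where

    private
      ∂ ∂′ : List (ℚ × X) → Fin n → ℚ
      ∂ = boundary ends
      ∂′ = boundary (merge² ∘ ends)

    boundary-merge-a : ∀ l → ∂′ l a ≡ ∂ l a ℚ.+ ∂ l b
    boundary-merge-a [] = ≡.refl
    boundary-merge-a ((c , x) ∷ l) = let i , j = ends x in ≡.trans
      (≡.cong₂ (λ p q → c ℚ.* p ℚ.+ q) (≡.cong₂ ℚ._-_ (δ-merge-a i) (δ-merge-a j)) (boundary-merge-a l))
      (solve 7 (λ c p q p′ q′ r s → c :* ((p :+ q) :- (p′ :+ q′)) :+ (r :+ s)
          := (c :* (p :- p′) :+ r) :+ (c :* (q :- q′) :+ s)) ≡.refl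
        c (δ i a) (δ i b) (δ j a) (δ j b) (∂ l a) (∂ l b))
      where open +-*-Solver

    boundary-merge : ∀ l {v} → a ≢ v → b ≢ v → ∂′ l v ≡ ∂ l v
    boundary-merge [] _ _ = ≡.refl
    boundary-merge ((c , x) ∷ l) a≢v b≢v = let i , j = ends x in
      ≡.cong₂ (λ p q → c ℚ.* p ℚ.+ q) (≡.cong₂ ℚ._-_ (δ-merge i a≢v b≢v) (δ-merge j a≢v b≢v)) (boundary-merge l a≢v b≢v)

    -- A dependence in the contraction lifts by giving the contracted pair
    -- the coefficient ∂ l b.
    lift-dependence : ∀ l → (∀ v → ∂′ l v ≡ 0ℚ) → ∀ v → ∂ l b ℚ.* vec (a , b) v ℚ.+ ∂ l v ≡ 0ℚ
    lift-dependence l ∂′≡0 v with v ≟ a | v ≟ b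
    ... | yes ≡.refl | _ = ≡.trans
      (≡.cong (λ p → ∂ l b ℚ.* p ℚ.+ ∂ l a) (≡.cong₂ ℚ._-_ (δ-refl a) (δ-≢ (≡.≢-sym a≢b))))
      (≡.trans (solve 2 (λ p q → p :* (con 1ℚ :- con 0ℚ) :+ q := q :+ p) ≡.refl (∂ l b) (∂ l a))
        (≡.trans (≡.sym (boundary-merge-a l)) (∂′≡0 a)))
      where open +-*-Solver
    ... | no _ | yes ≡.refl = ≡.trans
      (≡.cong (λ p → ∂ l b ℚ.* p ℚ.+ ∂ l b) (≡.cong₂ ℚ._-_ (δ-≢ a≢b) (δ-refl b)))
      (solve 1 (λ p → p :* (con 0ℚ :- con 1ℚ) :+ p := con 0ℚ) ≡.refl (∂ l b))
      where open +-*-Solver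
    ... | no v≢a | no v≢b = ≡.trans
      (≡.cong (λ p → ∂ l b ℚ.* p ℚ.+ ∂ l v) (≡.cong₂ ℚ._-_ (δ-≢ (≡.≢-sym v≢a)) (δ-≢ (≡.≢-sym v≢b))))
      (≡.trans (solve 2 (λ p q → p :* (con 0ℚ :- con 0ℚ) :+ q := q) ≡.refl (∂ l b) (∂ l v))
        (≡.trans (≡.sym (boundary-merge l (≡.≢-sym v≢a) (≡.≢-sym v≢b))) (∂′≡0 v)))
      where open +-*-Solver

  module _ {A : ℚAlgebra} (comm : Commutative A) {y : Fin n → Fin n → ℚAlgebra.Carrier A} (fk : FKFamily A y) where
    open ℚAlgebra A
    open FKFamily fk
    open AlgebraSolver A comm
    open SetoidReasoning setoid
    private
      module η = RingMorphisms.IsRingHomomorphism η-homo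
      Y d : Fin n → Fin n → Carrier
      Y i j = y (merge i) (merge j)
      d i j = η (orientation i j)

    -- The residue along the pair a b, which itself goes to ε.
    dual : Fin n → Fin n → Carrier × Carrier
    dual i j = Y i j , d i j

    private
      d≈0 : ∀ {i j} → merge i ≢ merge j → d i j ≈ 0#
      d≈0 {i} {j} m≢ = trans (η.⟦⟧-cong (orientation-distinct i j m≢)) η.0#-homo

      -- The coefficient `d i j` is zero unless `i` and `j` merge, so a cofactor has to be examined
      -- only in that case.
      absorb : ∀ i j {z} → (merge i ≡ merge j → z ≈ 0#) → d i j * z ≈ 0#
      absorb i j z≈0 with merge i ≟ merge j
      ... | yes m≡ = trans (*-congˡ (z≈0 m≡)) (zeroʳ _)
      ... | no m≢ = trans (*-congʳ (d≈0 {i} {j} m≢)) (zeroˡ _)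

      Y-equal : ∀ i j → merge i ≡ merge j → Y i j ≈ 0#
      Y-equal i j m≡ = trans (reflexive (≡.cong (y (merge i)) (≡.sym m≡))) (diagonal (merge i))

      Y-opposite : ∀ i j k → merge i ≡ merge j → Y j k + Y k i ≈ 0#
      Y-opposite i j k m≡ = trans (+-congˡ (trans (antisym (merge i) (merge k))
        (-‿cong (reflexive (≡.cong (λ i → y i (merge k)) m≡))))) (-‿inverseʳ _)

    -- The first components satisfy the relations because they come from a family. In the ε-part
    -- each `d i j` multiplies a quantity that vanishes when `i` and `j` merge: a diagonal value for
    -- the square, and for the triangle the sum of the other two sides, which have become opposite.
    dual-fk : FKFamily (Dual A) dual
    dual-fk = record
      { diagonal = λ i → diagonal (merge i) , trans (η.⟦⟧-cong (orientation-equal i)) η.0#-homo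
      ; antisym = λ i j → antisym (merge i) (merge j) , trans (η.⟦⟧-cong (orientation-antisym i j)) (η.-‿homo _)
      ; nilpotent = λ i j → nilpotent (merge i) (merge j)
          , trans (+-cong (trans (comm _ _) (absorb i j (Y-equal i j))) (absorb i j (Y-equal i j))) (+-identityˡ 0#)
      ; commute = λ _ _ _ _ → dual-commutative {A} comm _ _
      ; cyclic₃ = λ i j k → cyclic₃ (merge i) (merge j) (merge k) , (begin
          (Y i j * d j k + d i j * Y j k) + (Y j k * d k i + d j k * Y k i) + (Y k i * d i j + d k i * Y i j)
            ≈⟨ solve 6 (λ a b c p q r → (a :* q :+ p :* b) :+ (b :* r :+ q :* c) :+ (c :* p :+ r :* a)
                 := p :* (b :+ c) :+ q :* (c :+ a) :+ r :* (a :+ b)) refl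
                 (Y i j) (Y j k) (Y k i) (d i j) (d j k) (d k i) ⟩
          d i j * (Y j k + Y k i) + d j k * (Y k i + Y i j) + d k i * (Y i j + Y j k)
            ≈⟨ +-cong (+-cong (absorb i j (Y-opposite i j k)) (absorb j k (Y-opposite j k i))) (absorb k i (Y-opposite k i j)) ⟩
          0# + 0# + 0#
            ≈⟨ trans (+-identityʳ _) (+-identityʳ _) ⟩
          0# ∎)
      }
      where
      orientation-antisym : ∀ i j → orientation j i ≡ ℚ.- orientation i j
      orientation-antisym i j = solve′ 4 (λ p q r s → r ⊛ q ⊝′ s ⊛ p ⊜ ⊖ (p ⊛ s ⊝′ q ⊛ r)) ≡.refl
        (δ i a) (δ i b) (δ j a) (δ j b)
        where open +-*-Solver renaming (solve to solve′; _:*_ to _⊛_; _:-_ to _⊝′_; :-_ to ⊖_; _:=_ to _⊜_)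

-- Evaluation under homomorphisms and specialisation of dual numbers

module _ {A B : ℚAlgebra} {f : ℚAlgebra.Carrier A → ℚAlgebra.Carrier B} (f-hom : IsHom A B f)
  (f-η : ∀ q → ℚAlgebra._≈_ B (f (ℚAlgebra.η A q)) (ℚAlgebra.η B q)) {X : Set} where
  private
    module A = ℚAlgebra A
    module B = ℚAlgebra B
    module f = RingMorphisms.IsRingHomomorphism f-hom

  eval-fusion : ∀ {ρ : X → A.Carrier} {τ : X → B.Carrier} → (∀ x → f (ρ x) B.≈ τ x) →
    ∀ a → f (eval A ρ a) B.≈ eval B τ a
  eval-fusion fρ≈τ (gen x) = fρ≈τ x
  eval-fusion fρ≈τ (con q) = f-η q
  eval-fusion fρ≈τ (a ⊕ b) = B.trans (f.+-homo _ _) (B.+-cong (eval-fusion fρ≈τ a) (eval-fusion fρ≈τ b))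
  eval-fusion fρ≈τ (a ⊗ b) = B.trans (f.*-homo _ _) (B.*-cong (eval-fusion fρ≈τ a) (eval-fusion fρ≈τ b))
  eval-fusion fρ≈τ (⊝ a) = B.trans (f.-‿homo _) (B.-‿cong (eval-fusion fρ≈τ a))

  ∏-homo : ∀ {ρ : X → A.Carrier} l → f (∏ A ρ l) B.≈ ∏ B (f ∘ ρ) l
  ∏-homo [] = f.1#-homo
  ∏-homo (_ ∷ l) = B.trans (f.*-homo _ _) (B.*-congˡ (∏-homo l))

  ∂∏-homo : ∀ {ρ : X → A.Carrier} l → f (∂∏ A ρ l) B.≈ ∂∏ B (f ∘ ρ) l
  ∂∏-homo [] = f.0#-homo
  ∂∏-homo ((c , _) ∷ l) = B.trans (f.+-homo _ _) (B.+-cong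
    (B.trans (f.*-homo _ _) (B.*-cong (f-η c) (∏-homo l)))
    (B.trans (f.*-homo _ _) (B.*-congˡ (∂∏-homo l))))

module _ {A B : ℚAlgebra} {f : ℚAlgebra.Carrier A → ℚAlgebra.Carrier B} (f-hom : IsHom A B f) where
  private
    module A = ℚAlgebra A
    module B = ℚAlgebra B
    module f = RingMorphisms.IsRingHomomorphism f-hom

  dual-map : A.Carrier × A.Carrier → B.Carrier × B.Carrier
  dual-map (p , q) = f p , f q

  dual-map-hom : IsHom (Dual A) (Dual B) dual-map
  dual-map-hom = record
    { isSemiringHomomorphism = record
      { isNearSemiringHomomorphism = record
        { +-isMonoidHomomorphism = record
          { isMagmaHomomorphism = record
            { isRelHomomorphism = record { cong = λ (p , q) → f.⟦⟧-cong p , f.⟦⟧-cong q }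
            ; homo = λ _ _ → f.+-homo _ _ , f.+-homo _ _ }
          ; ε-homo = f.0#-homo , f.0#-homo }
        ; *-homo = λ _ _ → f.*-homo _ _ ,
            B.trans (f.+-homo _ _) (B.+-cong (f.*-homo _ _) (f.*-homo _ _)) }
      ; 1#-homo = f.1#-homo , f.0#-homo }
    ; -‿homo = λ _ → f.-‿homo _ , f.-‿homo _ }

  module _ (comm : Commutative B) (u : B.Carrier) (u²≈0 : u B.* u B.≈ B.0#) where
    open B
    open SetoidReasoning setoid
    open AlgebraSolver B comm

    -- The substitution of `u` for ε, multiplicative because `u` squares to zero just as ε does.
    dual-specialise : A.Carrier × A.Carrier → Carrier
    dual-specialise (p , q) = f p + u * f q

    dual-specialise-hom : IsHom (Dual A) B dual-specialise
    dual-specialise-hom = record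
      { isSemiringHomomorphism = record
        { isNearSemiringHomomorphism = record
          { +-isMonoidHomomorphism = record
            { isMagmaHomomorphism = record
              { isRelHomomorphism = record { cong = λ (p , q) → +-cong (f.⟦⟧-cong p) (*-congˡ (f.⟦⟧-cong q)) }
              ; homo = λ _ _ → trans (+-cong (f.+-homo _ _) (*-congˡ (f.+-homo _ _)))
                  (solve 5 (λ a b u c d → (a :+ b) :+ u :* (c :+ d) := (a :+ u :* c) :+ (b :+ u :* d)) refl _ _ u _ _) }
            ; ε-homo = trans (+-cong f.0#-homo (trans (*-congˡ f.0#-homo) (zeroʳ u))) (+-identityˡ 0#) }
          ; *-homo = λ (p , p′) (q , q′) → begin
              f (p A.* q) + u * f (p A.* q′ A.+ p′ A.* q)
                ≈⟨ +-cong (f.*-homo p q) (*-congˡ (trans (f.+-homo _ _) (+-cong (f.*-homo p q′) (f.*-homo p′ q)))) ⟩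
              f p * f q + u * (f p * f q′ + f p′ * f q)
                ≈⟨ solve 5 (λ a a′ b b′ u → a :* b :+ u :* (a :* b′ :+ a′ :* b)
                     := (a :* b :+ u :* (a :* b′ :+ a′ :* b)) :+ con 0ℚ :* (a′ :* b′)) refl (f p) (f p′) (f q) (f q′) u ⟩
              (f p * f q + u * (f p * f q′ + f p′ * f q)) + 0# * (f p′ * f q′)
                ≈⟨ +-congˡ (*-congʳ u²≈0) ⟨
              (f p * f q + u * (f p * f q′ + f p′ * f q)) + (u * u) * (f p′ * f q′)
                ≈⟨ solve 5 (λ a a′ b b′ u → (a :* b :+ u :* (a :* b′ :+ a′ :* b)) :+ (u :* u) :* (a′ :* b′)
                     := (a :+ u :* a′) :* (b :+ u :* b′)) refl (f p) (f p′) (f q) (f q′) u ⟩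
              (f p + u * f p′) * (f q + u * f q′) ∎ }
        ; 1#-homo = trans (+-cong f.1#-homo (trans (*-congˡ f.0#-homo) (zeroʳ u))) (+-identityʳ 1#) }
      ; -‿homo = λ _ → trans (+-cong (f.-‿homo _) (*-congˡ (f.-‿homo _)))
          (solve 3 (λ a u c → :- a :+ u :* :- c := :- (a :+ u :* c)) refl _ u _) }

-- The Orlik–Terao relations of a multigraph with loops; the dependences
-- involve no loops since they would otherwise make 1 vanish.
data Relator {n : ℕ} {X : Set} (ends : X → Fin n × Fin n) : Pred (Expr X) 0ℓ where
  square    : ∀ x → Relator ends (gen x ⊗ gen x)
  loop      : ∀ x → uncurry _≡_ (ends x) → Relator ends (gen x)
  dependent : ∀ l → All (λ (_ , x) → uncurry _≢_ (ends x)) l → (∀ v → boundary ends l v ≡ 0ℚ) →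
    Relator ends (∂∏ (Free X) gen l)

MultigraphAlgebra : {n : ℕ} {X : Set} → (X → Fin n × Fin n) → ℚAlgebra
MultigraphAlgebra {X = X} ends = Quotient (Abelianization (Free X)) (Relator ends)

module _ {n : ℕ} {X : Set} (ends : X → Fin n × Fin n) (A : ℚAlgebra) (comm : Commutative A)
  (ρ : X → ℚAlgebra.Carrier A) where
  open ℚAlgebra A

  record IsModel : Set where
    field
      nilpotent  : ∀ x → ρ x * ρ x ≈ 0#
      loop≈0     : ∀ x → uncurry _≡_ (ends x) → ρ x ≈ 0#
      dependence : ∀ l → All (λ (_ , x) → uncurry _≢_ (ends x)) l → (∀ v → boundary ends l v ≡ 0ℚ) → ∂∏ A ρ l ≈ 0#

  module _ (model : IsModel) where
    open IsModel model

    model-relator : ∀ {r} → Relator ends r → eval A ρ r ≈ 0#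
    model-relator (square x) = nilpotent x
    model-relator (loop x p) = loop≈0 x p
    model-relator (dependent l nl ∂≡0) = trans (∂∏-homo {Free X} {A} (eval-hom A ρ) (λ _ → refl) l) (dependence l nl ∂≡0)

    multigraph-eval-hom : IsHom (MultigraphAlgebra ends) A (eval A ρ)
    multigraph-eval-hom = Hom.quotient-hom {Abelianization (Free X)} {A} (abelian-eval-hom A ρ comm) model-relator

id-hom : {A : ℚAlgebra} → IsHom A A id
id-hom {A} = record
  { isSemiringHomomorphism = record
    { isNearSemiringHomomorphism = record
      { +-isMonoidHomomorphism = record
        { isMagmaHomomorphism = record
          { isRelHomomorphism = record { cong = λ p → p }
          ; homo = λ _ _ → A.refl }
        ; ε-homo = A.refl }
      ; *-homo = λ _ _ → A.refl }
    ; 1#-homo = A.refl }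
  ; -‿homo = λ _ → A.refl }
  where module A = ℚAlgebra A

into-quotient : ∀ {A B : ℚAlgebra} {S : Pred (ℚAlgebra.Carrier B) 0ℓ} {f} → IsHom A B f → IsHom A (Quotient B S) f
into-quotient {A} {B} {S} f-hom = record
  { isSemiringHomomorphism = record
    { isNearSemiringHomomorphism = record
      { +-isMonoidHomomorphism = record
        { isMagmaHomomorphism = record
          { isRelHomomorphism = record { cong = λ p → ≈⇒≈ᵢ B (f.⟦⟧-cong p) }
          ; homo = λ x y → ≈⇒≈ᵢ B (f.+-homo x y) }
        ; ε-homo = ≈⇒≈ᵢ B f.0#-homo }
      ; *-homo = λ x y → ≈⇒≈ᵢ B (f.*-homo x y) }
    ; 1#-homo = ≈⇒≈ᵢ B f.1#-homo }
  ; -‿homo = λ x → ≈⇒≈ᵢ B (f.-‿homo x) }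
  where module f = RingMorphisms.IsRingHomomorphism f-hom

hom≈eval : {A : ℚAlgebra} {X : Set} {f : Expr X → ℚAlgebra.Carrier A} → IsHom (Free X) A f →
  (∀ q → ℚAlgebra._≈_ A (f (con q)) (ℚAlgebra.η A q)) → ∀ a → ℚAlgebra._≈_ A (f a) (eval A (f ∘ gen) a)
hom≈eval {A} {X} {f} f-hom f-η a = ≡.subst (λ c → f c ≈ eval A (f ∘ gen) a) (eval-gen a)
    (eval-fusion {Free X} {A} {f} f-hom f-η {ρ = gen} (λ _ → refl) a)
  where open ℚAlgebra A

module _ {X : Set} {S : Pred (Expr X) 0ℓ} where
  private
    F = Free X
    F^ab = Abelianization F
    U = Quotient F^ab S
  open ℚAlgebra U

  presented-commutative : Commutative U
  presented-commutative = quotient-commutative {F^ab} {S} (abelianization-commutative F)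

  presentation-hom : IsHom F U id
  presentation-hom = into-quotient {F} {F^ab} {S} (into-quotient {F} {F} {Commutator F} (id-hom {F}))

  presentation-relator : ∀ {r} → S r → r ≈ 0#
  presentation-relator {r} p = ideal⇒≈0 F^ab {S} {r} (base p)

  eval≈0⇒ideal : ∀ a → eval U gen a ≈ 0# → Ideal F^ab S a
  eval≈0⇒ideal a eval≈0 = ≈0⇒ideal F^ab (trans {a} {eval U gen a} {0#}
    (hom≈eval {U} {X} {id} presentation-hom (λ q → refl {con q}) a) eval≈0)

module _ {n : ℕ} {X : Set} (ends : X → Fin n × Fin n) where
  private
    F = Free X
    U = MultigraphAlgebra ends
  open ℚAlgebra U

  multigraph-commutative : Commutative U
  multigraph-commutative = presented-commutative {X} {Relator ends}

  universal-model : IsModel ends U multigraph-commutative gen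
  universal-model = record
    { nilpotent = λ x → presentation-relator (square x)
    ; loop≈0 = λ x p → presentation-relator (loop x p)
    ; dependence = λ l nl ∂≡0 → trans {∂∏ U gen l} {∂∏ F gen l} {0#}
        (sym {∂∏ F gen l} {∂∏ U gen l}
          (∂∏-homo {F} {U} {id} (presentation-hom {X} {Relator ends}) (λ q → refl {con q}) l))
        (presentation-relator (dependent l nl ∂≡0))
    }

module _ {X Y : Set} (A : ℚAlgebra) (ρ : Y → ℚAlgebra.Carrier A) (f : X → Y) where
  open ℚAlgebra A

  ∏-map : ∀ l → ∏ A ρ (map (map₂ f) l) ≡ ∏ A (ρ ∘ f) l
  ∏-map [] = ≡.refl
  ∏-map ((_ , x) ∷ l) = ≡.cong (ρ (f x) *_) (∏-map l)

  ∂∏-map : ∀ l → ∂∏ A ρ (map (map₂ f) l) ≡ ∂∏ A (ρ ∘ f) l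
  ∂∏-map [] = ≡.refl
  ∂∏-map ((c , x) ∷ l) = ≡.cong₂ (λ p r → η c * p + ρ (f x) * r) (∏-map l) (∂∏-map l)

fk-model : {n : ℕ} {X : Set} (ends : X → Fin n × Fin n) (A : ℚAlgebra) (comm : Commutative A)
  {y : Fin n → Fin n → ℚAlgebra.Carrier A} → FKFamily A y → IsModel ends A comm (uncurry y ∘ ends)
fk-model ends A comm {y} fk = record
  { nilpotent = λ x → uncurry nilpotent (ends x)
  ; loop≈0 = λ x p → trans (reflexive (≡.cong (y (proj₁ (ends x))) (≡.sym p))) (diagonal _)
  ; dependence = λ l nl ∂≡0 → trans (reflexive (≡.sym (∂∏-map A (uncurry y) ends l)))
      (fk-dependence fk comm (map (map₂ ends) l) (Allₚ.map⁺ nl)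
        (λ v → ≡.trans (boundary-map ends id l v) (∂≡0 v)))
  }
  where
  open ℚAlgebra A
  open FKFamily fk

-- The quantification over all commutative algebras is essential for the induction: vanishing for
-- the contraction over `B` is deduced from vanishing over `Dual B`.
FKVanishing : {n : ℕ} {X : Set} → (X → Fin n × Fin n) → Expr X → Set₁
FKVanishing {n} ends b = ∀ (A : ℚAlgebra) → Commutative A → ∀ {y : Fin n → Fin n → ℚAlgebra.Carrier A} → FKFamily A y →
  ℚAlgebra._≈_ A (eval A (uncurry y ∘ ends) b) (ℚAlgebra.0# A)

module RingLemmas (A : ℚAlgebra) (comm : Commutative A) where
  open ℚAlgebra A
  open SetoidReasoning setoid
  open AlgebraSolver A comm
  private
    module η = RingMorphisms.IsRingHomomorphism η-homo

  -- For two terms with coefficients `c` and -1, `∂∏` is just `c` times `ρ z` minus `ρ x`.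
  two-term-dependence : ∀ {X : Set} (ρ : X → Carrier) c x z → ∂∏ A ρ ((c , x) ∷ (ℚ.- 1ℚ , z) ∷ []) ≈ 0# → ρ x ≈ ρ z * η c
  two-term-dependence ρ c x z ∂∏≈0 = begin
    ρ x
      ≈⟨ solve 3 (λ c u g → g
           := u :* c :- (c :* (u :* con 1ℚ) :+ g :* (:- con 1ℚ :* con 1ℚ :+ u :* con 0ℚ))) refl (η c) (ρ z) (ρ x) ⟩
    ρ z * η c - (η c * (ρ z * 1#) + ρ x * (- 1# * 1# + ρ z * 0#))
      ≈⟨ +-congˡ (-‿cong (+-congˡ (*-congˡ (+-congʳ (*-congʳ (trans (η.-‿homo 1ℚ) (-‿cong η.1#-homo))))))) ⟨
    ρ z * η c - ∂∏ A ρ ((c , x) ∷ (ℚ.- 1ℚ , z) ∷ [])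
      ≈⟨ +-congˡ (-‿cong ∂∏≈0) ⟩
    ρ z * η c - 0#
      ≈⟨ trans (+-congˡ (RingProperties.-0#≈0# ring)) (+-identityʳ _) ⟩
    ρ z * η c ∎

  first-term : ∀ {p q} → p + q ≈ 0# → q ≈ - p
  first-term {p} {q} = RingProperties.+-inverseʳ-unique ring p q

  rotate : ∀ u d p → u * (d * p) ≈ d * (u * p)
  rotate = solve 3 (λ u d p → u :* (d :* p) := d :* (u :* p)) refl

-- Elimination of an edge

module FirstEdge {n m : ℕ} (ends : Fin (suc m) → Fin n × Fin n)
  (A : ℚAlgebra) (comm : Commutative A) (ρ : Fin (suc m) → ℚAlgebra.Carrier A) (model : IsModel ends A comm ρ) where
  open ℚAlgebra A hiding (zero)
  open SetoidReasoning setoid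
  open IsModel model

  tail-ends : Fin m → Fin n × Fin n
  tail-ends = ends ∘ suc

  ι : Expr (Fin m) → Carrier
  ι = eval A (ρ ∘ suc)

  tail-model : IsModel tail-ends A comm (ρ ∘ suc)
  tail-model = record
    { nilpotent = nilpotent ∘ suc
    ; loop≈0 = loop≈0 ∘ suc
    ; dependence = λ l nl ∂≡0 → trans (reflexive (≡.sym (∂∏-map A ρ suc l)))
        (dependence (map (map₂ suc) l) (Allₚ.map⁺ nl) (λ v → ≡.trans (boundary-map suc ends l v) (∂≡0 v)))
    }

  ι-vanishes : ∀ {c} → Ideal (Abelianization (Free (Fin m))) (Relator tail-ends) c → ι c ≈ 0#
  ι-vanishes = Hom.ideal-vanishes {Abelianization (Free (Fin m))} {A} (abelian-eval-hom A _ comm)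
    (model-relator tail-ends A comm _ tail-model)

  module LoopFirst (is-loop : uncurry _≡_ (ends zero)) where

    remove : Expr (Fin (suc m)) → Expr (Fin m)
    remove = eval (Free (Fin m)) λ where
      zero → con 0ℚ
      (suc x) → gen x

    remove-correct : ∀ c → eval A ρ c ≈ ι (remove c)
    remove-correct c = sym (eval-fusion {Free (Fin m)} {A} (eval-hom A (ρ ∘ suc)) (λ _ → refl) (λ where
          zero → trans η.0#-homo (sym (loop≈0 zero is-loop))
          (suc x) → refl) c)
      where module η = RingMorphisms.IsRingHomomorphism η-homo

  module ContractFirst (nonloop : uncurry _≢_ (ends zero)) where
    open RingLemmas A comm
    private
      module η = RingMorphisms.IsRingHomomorphism η-homo
      a b : Fin n
      a = proj₁ (ends zero)
      b = proj₂ (ends zero)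
    open Contraction a b nonloop

    contracted : Fin m → Fin n × Fin n
    contracted = merge² ∘ tail-ends

    u : Carrier
    u = ρ zero

    u² : u * u ≈ 0#
    u² = nilpotent zero

    times-η0 : u * η 0ℚ ≈ 0#
    times-η0 = trans (*-congˡ η.0#-homo) (zeroʳ u)

    -- An edge that the contraction turns into a loop is a multiple of the first edge, so its
    -- variable becomes a multiple of ε; every other variable is kept.
    split-tail : Fin m → Fin n × Fin n → Expr (Fin m) × Expr (Fin m)
    split-tail x (i , j) = if does (merge i ≟ merge j) then (con 0ℚ , con (orientation i j)) else (gen x , con 0ℚ)

    split-gen : Fin (suc m) → Expr (Fin m) × Expr (Fin m)
    split-gen zero = con 0ℚ , con 1ℚ
    split-gen (suc x) = split-tail x (tail-ends x)

    split : Expr (Fin (suc m)) → Expr (Fin m) × Expr (Fin m)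
    split = eval (Dual (Free (Fin m))) split-gen

    -- Loops vanish outright. An edge joining the ends of the first edge has the same vector up to
    -- sign, and the two-term dependence compares the variables.
    parallel-edge : ∀ x → uncurry Merged (ends x) → ρ x ≈ u * η (uncurry orientation (ends x))
    parallel-edge x mg = go (ends x) ≡.refl mg
      where
      two-term : ∀ c {i j} → ends x ≡ (i , j) → i ≢ j → (∀ v → c ℚ.* vec (i , j) v ≡ vec (a , b) v) → ρ x ≈ u * η c
      two-term c {i} {j} eq i≢j same = two-term-dependence ρ c x zero (dependence l nl ∂≡0)
        where
        l = (c , x) ∷ (ℚ.- 1ℚ , zero) ∷ []
        nl : All (λ (_ , x) → uncurry _≢_ (ends x)) l
        nl = ≡.subst (uncurry _≢_) (≡.sym eq) i≢j ∷ nonloop ∷ []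
        ∂≡0 : ∀ v → boundary ends l v ≡ 0ℚ
        ∂≡0 v = ≡.trans (≡.cong (λ p → p ℚ.+ _) (≡.trans (≡.cong (λ e → c ℚ.* vec e v) eq) (same v)))
          (solve′ 1 (λ p → p ⊞ (⊖ con′ 1ℚ ⊛ p ⊞ con′ 0ℚ) ⊜ con′ 0ℚ) ≡.refl (vec (a , b) v))
          where open +-*-Solver renaming (solve to solve′; _:*_ to _⊛_; _:+_ to _⊞_; :-_ to ⊖_; con to con′; _:=_ to _⊜_)
      go : ∀ e → ends x ≡ e → uncurry Merged e → ρ x ≈ u * η (uncurry orientation e)
      go (i , .i) eq equal = trans (loop≈0 x (≡.subst (uncurry _≡_) (≡.sym eq) ≡.refl))
        (sym (trans (*-congˡ (trans (η.⟦⟧-cong (orientation-equal i)) η.0#-homo)) (zeroʳ u)))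
      go _ eq parallel = trans (two-term 1ℚ eq nonloop (λ v → ℚₚ.*-identityˡ _))
        (*-congˡ (η.⟦⟧-cong (≡.sym orientation-parallel)))
      go _ eq opposite = trans (two-term (ℚ.- 1ℚ) eq (≡.≢-sym nonloop)
          (λ v → solve′ 2 (λ p q → ⊖ con′ 1ℚ ⊛ (p ⊝′ q) ⊜ q ⊝′ p) ≡.refl (δ b v) (δ a v)))
        (*-congˡ (η.⟦⟧-cong (≡.sym orientation-opposite)))
        where open +-*-Solver renaming (solve to solve′; _:*_ to _⊛_; _:-_ to _⊝′_; :-_ to ⊖_; con to con′; _:=_ to _⊜_)

    -- Both sides are evaluations of `c`, the right one through the dual numbers followed by ε ↦ u,
    -- so agreement on the generators suffices.
    split-correct : ∀ c → eval A ρ c ≈ ι (proj₁ (split c)) + u * ι (proj₂ (split c))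
    split-correct c = sym
      (eval-fusion {Dual (Free (Fin m))} {A}
        (dual-specialise-hom {Free (Fin m)} {A} (eval-hom A (ρ ∘ suc)) comm u u²)
        (λ q → trans (+-congˡ times-η0) (+-identityʳ _))
        (λ where
          zero → trans (+-cong η.0#-homo (trans (*-congˡ η.1#-homo) (*-identityʳ u))) (+-identityˡ u)
          (suc x) → at-tail x)
        c)
      where
      at-tail : ∀ x → ι (proj₁ (split-tail x (tail-ends x))) + u * ι (proj₂ (split-tail x (tail-ends x))) ≈ ρ (suc x)
      at-tail x with merge (proj₁ (tail-ends x)) ≟ merge (proj₂ (tail-ends x))
      ... | yes m≡ = trans (trans (+-congʳ η.0#-homo) (+-identityˡ _)) (sym (parallel-edge (suc x) (merged _ _ m≡)))
      ... | no _ = trans (+-congˡ times-η0) (+-identityʳ _)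

    -- A family for the contraction yields the family `dual` for the original ends. The ε-part of
    -- the value of `c` there is the value of `proj₂ (split c)` on the given family.
    contracted-vanishing : ∀ {c} → FKVanishing ends c → FKVanishing contracted (proj₂ (split c))
    contracted-vanishing {c} vanishing B B-comm {y} fk = proj₂ (D.trans
        (eval-fusion {Dual (Free (Fin m))} {Dual B}
          (dual-map-hom {Free (Fin m)} {B} (eval-hom B τ)) (λ q → B.refl , ηB.0#-homo) pointwise c)
        (vanishing (Dual B) (dual-commutative {B} B-comm) (dual-fk B-comm fk)))
      where
      module B = ℚAlgebra B
      module D = ℚAlgebra (Dual B)
      module ηB = RingMorphisms.IsRingHomomorphism B.η-homo
      τ = uncurry y ∘ contracted
      y-equal : ∀ {i j} → i ≡ j → B.0# B.≈ y i j
      y-equal ≡.refl = B.sym (FKFamily.diagonal fk _)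
      pointwise : ∀ x → dual-map {Free (Fin m)} {B} (eval-hom B τ) (split-gen x) D.≈ uncurry (dual B-comm fk) (ends x)
      pointwise zero = B.trans ηB.0#-homo (y-equal (≡.trans merge-a (≡.sym merge-b))) , ηB.⟦⟧-cong (≡.sym orientation-parallel)
      pointwise (suc x) with merge (proj₁ (tail-ends x)) ≟ merge (proj₂ (tail-ends x))
      ... | yes m≡ = B.trans ηB.0#-homo (y-equal m≡) , B.refl
      ... | no m≢ = B.refl , ηB.⟦⟧-cong (≡.sym (orientation-distinct (proj₁ (tail-ends x)) (proj₂ (tail-ends x)) m≢))

    -- A dependence of the contraction lifts to one that involves the first edge
    -- just once, so multiplying by the first edge eliminates it.
    first-times-contracted : ∀ {c} → Ideal (Abelianization (Free (Fin m))) (Relator contracted) c →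
      ∃[ c′ ] u * ι c ≈ ι c′
    first-times-contracted (resp p≈q p) = let c′ , eq = first-times-contracted p in
      c′ , trans (*-congˡ (sym (RingMorphisms.IsRingHomomorphism.⟦⟧-cong (abelian-eval-hom A (ρ ∘ suc) comm) p≈q))) eq
    first-times-contracted (base (square x)) = con 0ℚ ,
      trans (*-congˡ (nilpotent (suc x))) (trans (zeroʳ u) (sym η.0#-homo))
    -- The variable of a loop of the contraction is itself a multiple of `u`, and a second factor
    -- `u` kills it.
    first-times-contracted (base (loop x m≡)) = con 0ℚ , (begin
      u * ρ (suc x)   ≈⟨ *-congˡ (parallel-edge (suc x) (merged _ _ m≡)) ⟩
      u * (u * η o)     ≈⟨ *-assoc u u (η o) ⟨
      (u * u) * η o     ≈⟨ *-congʳ u² ⟩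
      0# * η o          ≈⟨ zeroˡ _ ⟩
      0#                ≈⟨ η.0#-homo ⟨
      η 0ℚ              ∎)
      where o = uncurry orientation (tail-ends x)
    -- The lifted dependence reads `η c * ∏ + u * ∂∏ ≈ 0#`, where `c` is the boundary of `l` at `b`;
    -- solving for the second summand gives the witness.
    first-times-contracted (base (dependent l nl ∂≡0)) = ⊝ (con c ⊗ ∏ (Free (Fin m)) gen l) , (begin
      u * ι (∂∏ (Free (Fin m)) gen l)
        ≈⟨ *-congˡ (∂∏-homo {Free (Fin m)} {A} (eval-hom A (ρ ∘ suc)) (λ _ → refl) l) ⟩
      u * ∂∏ A (ρ ∘ suc) l
        ≈⟨ first-term lifted ⟩
      - (η c * ∏ A (ρ ∘ suc) l)
        ≈⟨ -‿cong (*-congˡ (∏-homo {Free (Fin m)} {A} (eval-hom A (ρ ∘ suc)) (λ _ → refl) l)) ⟨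
      - (η c * ι (∏ (Free (Fin m)) gen l)) ∎)
      where
      c = boundary tail-ends l b
      lifted : η c * ∏ A (ρ ∘ suc) l + u * ∂∏ A (ρ ∘ suc) l ≈ 0#
      lifted = trans
        (reflexive (≡.sym (≡.cong₂ (λ p r → η c * p + u * r) (∏-map A ρ suc l) (∂∏-map A ρ suc l))))
        (dependence ((c , zero) ∷ map (map₂ suc) l)
          (nonloop ∷ Allₚ.map⁺ (All.map (λ m≢ i≡j → m≢ (≡.cong merge i≡j)) nl))
          (λ v → ≡.trans (≡.cong (c ℚ.* vec (a , b) v ℚ.+_) (boundary-map suc ends l v)) (lift-dependence tail-ends l ∂≡0 v)))
    first-times-contracted zer = con 0ℚ , trans times-η0 (sym η.0#-homo)
    first-times-contracted (add p q) =
      let p′ , eq = first-times-contracted p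
          q′ , eq′ = first-times-contracted q
      in p′ ⊕ q′ , trans (distribˡ u _ _) (+-cong eq eq′)
    first-times-contracted (mulˡ d p) = let p′ , eq = first-times-contracted p in
      d ⊗ p′ , trans (rotate u (ι d) _) (*-congˡ eq)
    first-times-contracted (mulʳ d p) = let p′ , eq = first-times-contracted p in
      p′ ⊗ d , trans (sym (*-assoc u _ (ι d))) (*-congʳ eq)

  -- A stands for the universal model, from which every family is reached.
  module _
    (universal : ∀ (B : ℚAlgebra) → Commutative B → ∀ {y : Fin n → Fin n → ℚAlgebra.Carrier B} → FKFamily B y →
      ∃[ f ] IsHom A B f × (∀ q → ℚAlgebra._≈_ B (f (η q)) (ℚAlgebra.η B q))
           × (∀ x → ℚAlgebra._≈_ B (f (ρ x)) (uncurry y (ends x))))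
    (hypothesis : ∀ (ends′ : Fin m → Fin n × Fin n) c → FKVanishing ends′ c →
      Ideal (Abelianization (Free (Fin m))) (Relator ends′) c) where

    -- The identity between `b` and `c` is known in `A` only; the homomorphisms out of `A` carry it
    -- to every family.
    tail-vanishing : ∀ {b} c → eval A ρ b ≈ ι c → FKVanishing ends b → FKVanishing tail-ends c
    tail-vanishing {b} c b≈ιc vanishing B B-comm {y} fk =
      let f , f-hom , f-η , fρ≈y = universal B B-comm fk in
      B.trans (B.sym (eval-fusion {A} {B} {f} f-hom f-η (fρ≈y ∘ suc) c))
        (B.trans (RingMorphisms.IsRingHomomorphism.⟦⟧-cong f-hom (sym b≈ιc))
          (B.trans (eval-fusion {A} {B} {f} f-hom f-η fρ≈y b) (vanishing B B-comm fk)))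
      where module B = ℚAlgebra B

    reduce : ∀ b → FKVanishing ends b → ∃[ c ] eval A ρ b ≈ ι c
    reduce b vanishing with proj₁ (ends zero) ≟ proj₂ (ends zero)
    ... | yes is-loop = remove b , remove-correct b
      where open LoopFirst is-loop
    ... | no nonloop =
      let c , eq = first-times-contracted (hypothesis contracted (proj₂ (split b)) (contracted-vanishing {b} vanishing))
      in proj₁ (split b) ⊕ c , trans (split-correct b) (+-congˡ eq)
      where open ContractFirst nonloop

    vanishing⇒≈0 : ∀ b → FKVanishing ends b → eval A ρ b ≈ 0#
    vanishing⇒≈0 b vanishing =
      let c , eq = reduce b vanishing
      in trans eq (ι-vanishes (hypothesis tail-ends c (tail-vanishing {b} c eq vanishing)))

constant-expr : ∀ (ρ : Fin 0 → ℚ) (b : Expr (Fin 0)) → b ∼ con (eval rationals ρ b)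
constant-expr ρ (con q) = ∼-refl
constant-expr ρ (a ⊕ b) = ∼-trans (⊕-cong (constant-expr ρ a) (constant-expr ρ b)) (∼-sym (con-⊕ _ _))
constant-expr ρ (a ⊗ b) = ∼-trans (⊗-cong (constant-expr ρ a) (constant-expr ρ b)) (∼-sym (con-⊗ _ _))
constant-expr ρ (⊝ a) = ∼-trans (⊝-cong (constant-expr ρ a)) (∼-sym (con-⊝ _))

zero-fk : ∀ {n} → FKFamily rationals {n} (λ _ _ → 0ℚ)
zero-fk = record
  { diagonal = λ _ → ≡.refl ; antisym = λ _ _ → ≡.refl ; nilpotent = λ _ _ → ≡.refl
  ; commute = λ _ _ _ _ → ≡.refl ; cyclic₃ = λ _ _ _ → ≡.refl }

-- The induction hypothesis has to cover arbitrary ends, since it is applied twice: to the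
-- contraction of the first edge and then to its deletion.
completeness : ∀ {n} m (ends : Fin m → Fin n × Fin n) b → FKVanishing ends b →
  Ideal (Abelianization (Free (Fin m))) (Relator ends) b
-- Without edges `b` is a rational constant, and its value on the zero family over the rationals
-- shows that this constant is 0.
completeness zero ends b vanishing = resp (≈⇒≈ᵢ (Free (Fin 0)) (∼-sym
  (≡.subst (λ q → b ∼ con q) (vanishing rationals ℚₚ.*-comm zero-fk) (constant-expr _ b)))) zer
completeness (suc m) ends b vanishing = eval≈0⇒ideal {S = Relator ends} b
  (FirstEdge.vanishing⇒≈0 ends (MultigraphAlgebra ends) (multigraph-commutative ends) gen (universal-model ends)
    (λ B comm {y} fk → eval B (uncurry y ∘ ends)
      , multigraph-eval-hom ends B comm _ (fk-model ends B comm fk)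
      , (λ _ → ℚAlgebra.refl B) , (λ _ → ℚAlgebra.refl B))
    (completeness m) b vanishing)

-- Relations indexed by vectors, and monomials containing a cycle

module _ (A : ℚAlgebra) {X : Set} (ρ : X → ℚAlgebra.Carrier A) where
  open ℚAlgebra A hiding (zero)

  -- The sum as it appears in OTRelator.dependent.
  omitSum : ∀ {k} → Vector ℚ (suc k) → Vector X (suc k) → Carrier
  omitSum c e = sum λ p → η (c p) * product (ρ ∘ removeAt e p)

  product≡∏ : ∀ {k} (c : Vector ℚ k) (e : Vector X k) → product (ρ ∘ e) ≡ ∏ A ρ (tabulate λ p → c p , e p)
  product≡∏ {zero} c e = ≡.refl
  product≡∏ {suc k} c e = ≡.cong (ρ (e zero) *_) (product≡∏ (c ∘ suc) (e ∘ suc))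

  module _ (comm : Commutative A) where

    private
      sum-scale : ∀ {k} u (s t : Vector Carrier k) → (∀ p → s p ≈ u * t p) → sum s ≈ u * sum t
      sum-scale {zero} u s t _ = sym (zeroʳ u)
      sum-scale {suc k} u s t s≈ut =
        trans (+-cong (s≈ut zero) (sum-scale u (s ∘ suc) (t ∘ suc) (s≈ut ∘ suc))) (sym (distribˡ u _ _))

      exchange : ∀ a b c → a * (b * c) ≈ b * (a * c)
      exchange a b c = trans (sym (*-assoc a b c)) (trans (*-congʳ (comm a b)) (*-assoc b a c))

    omitSum≈∂∏ : ∀ {k} (c : Vector ℚ (suc k)) (e : Vector X (suc k)) →
      omitSum c e ≈ ∂∏ A ρ (tabulate λ p → c p , e p)
    omitSum≈∂∏ {zero} c e = +-congˡ (sym (zeroʳ _))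
    omitSum≈∂∏ {suc k} c e = +-cong
      (*-congˡ (reflexive (product≡∏ (c ∘ suc) (e ∘ suc))))
      (trans (sum-scale (ρ (e zero))
          (λ p → η (c (suc p)) * product (ρ ∘ removeAt e (suc p)))
          (λ p → η (c (suc p)) * product (ρ ∘ removeAt (e ∘ suc) p))
          (λ p → exchange _ _ _))
        (*-congˡ (omitSum≈∂∏ (c ∘ suc) (e ∘ suc))))

    product-repeat≈0 : ∀ {k} (e : Vector X k) {p q} → p ≢ q → ρ (e p) * ρ (e q) ≈ 0# → product (ρ ∘ e) ≈ 0#
    product-repeat≈0 {suc zero} e {zero} {zero} p≢q _ = contradiction ≡.refl p≢q
    product-repeat≈0 {suc (suc k)} e {p} {q} p≢q e≈0 = begin
      product (ρ ∘ e)
        ≈⟨ sum-remove {i = p} (ρ ∘ e) ⟩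
      ρ (e p) * product (ρ ∘ removeAt e p)
        ≈⟨ *-congˡ (sum-remove {i = punchOut p≢q} (ρ ∘ removeAt e p)) ⟩
      ρ (e p) * (ρ (removeAt e p (punchOut p≢q)) * _)
        ≈⟨ *-congˡ (*-congʳ (reflexive (≡.cong (ρ ∘ e) (punchIn-punchOut p≢q)))) ⟩
      ρ (e p) * (ρ (e q) * _)
        ≈⟨ *-assoc _ _ _ ⟨
      (ρ (e p) * ρ (e q)) * _
        ≈⟨ trans (*-congʳ e≈0) (zeroˡ _) ⟩
      0# ∎
      where
      open SetoidReasoning setoid
      open Sum (CommutativeRing.*-commutativeMonoid (commutativeRing A comm)) using (sum-remove)

module _ {A B : ℚAlgebra} {f : ℚAlgebra.Carrier A → ℚAlgebra.Carrier B} (f-hom : IsHom A B f) where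
  private
    module A = ℚAlgebra A
    module B = ℚAlgebra B
    module f = RingMorphisms.IsRingHomomorphism f-hom

  sum-homo : ∀ {k} (t : Vector A.Carrier k) → f (A.sum t) B.≈ B.sum (f ∘ t)
  sum-homo {zero} t = f.0#-homo
  sum-homo {suc k} t = B.trans (f.+-homo _ _) (B.+-congˡ (sum-homo (t ∘ suc)))

  product-homo : ∀ {k} (t : Vector A.Carrier k) → f (A.product t) B.≈ B.product (f ∘ t)
  product-homo {zero} t = f.1#-homo
  product-homo {suc k} t = B.trans (f.*-homo _ _) (B.*-congˡ (product-homo (t ∘ suc)))

  omitSum-homo : (∀ q → f (A.η q) B.≈ B.η q) → ∀ {X : Set} (ρ : X → A.Carrier) {k} (c : Vector ℚ (suc k)) e →
    f (omitSum A ρ c e) B.≈ omitSum B (f ∘ ρ) c e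
  omitSum-homo f-η ρ c e = B.trans (sum-homo λ p → A.η (c p) A.* A.product (ρ ∘ removeAt e p))
    (go {s = λ p → f (A.η (c p) A.* A.product (ρ ∘ removeAt e p))} λ p →
      B.trans (f.*-homo _ _) (B.*-cong (f-η (c p)) (product-homo (ρ ∘ removeAt e p))))
    where
    go : ∀ {k} {s t : Vector B.Carrier k} → (∀ p → s p B.≈ t p) → B.sum s B.≈ B.sum t
    go {zero} _ = B.refl
    go {suc k} {s} {t} s≈t = B.+-cong (s≈t zero) (go {k} {s ∘ suc} {t ∘ suc} (s≈t ∘ suc))

extract : ∀ {X : Set} {P : Pred X 0ℓ} {xs} → Any P xs → ∃[ x ] ∃[ ys ] P x × xs ↭ x ∷ ys
extract {xs = x ∷ xs} (here px) = x , xs , px , ↭-refl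
extract {xs = x ∷ xs} (there pxs) = let y , ys , py , p = extract pxs in
  y , x ∷ ys , py , ↭-trans (prep x p) (swap x y ↭-refl)

module _ {n : ℕ} where
  open RawMonoidDefinitions ℚ.+-0-rawMonoid using () renaming (sum to sumℚ)

  sumℚ≡boundary : ∀ {X : Set} (ends : X → Fin n × Fin n) {k} (c : Vector ℚ k) (e : Vector X k) v →
    sumℚ (λ p → c p ℚ.* vec (ends (e p)) v) ≡ boundary ends (tabulate λ p → c p , e p) v
  sumℚ≡boundary ends {zero} c e v = ≡.refl
  sumℚ≡boundary ends {suc k} c e v = ≡.cong (c zero ℚ.* vec (ends (e zero)) v ℚ.+_) (sumℚ≡boundary ends (c ∘ suc) (e ∘ suc) v)

  Same : Fin n × Fin n → Fin n × Fin n → Set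
  Same (s , t) (i , j) = (s ≡ i × t ≡ j) ⊎ (s ≡ j × t ≡ i)

  same-unique : ∀ {e l l′} → Same e l → Same e l′ → Same l l′
  same-unique (inj₁ (≡.refl , ≡.refl)) s = s
  same-unique (inj₂ (≡.refl , ≡.refl)) (inj₁ (≡.refl , ≡.refl)) = inj₂ (≡.refl , ≡.refl)
  same-unique (inj₂ (≡.refl , ≡.refl)) (inj₂ (≡.refl , ≡.refl)) = inj₁ (≡.refl , ≡.refl)

  Covers : List (ℚ × Fin n × Fin n) → ℚ × Fin n × Fin n → Set
  Covers es (_ , l) = Any (λ (_ , e) → Same e l) es

  steps-avoid : ∀ {u : Fin n} h ws → All (u ≢_) (h ∷ map proj₂ ws) →
    All (λ (_ , i , j) → u ≢ i × u ≢ j) (steps h ws)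
  steps-avoid h [] _ = []
  steps-avoid h ((_ , w) ∷ ws) (u≢h ∷ u∉@(u≢w ∷ _)) = (u≢h , u≢w) ∷ steps-avoid w ws u∉

  DistinctSteps : List (ℚ × Fin n × Fin n) → Set
  DistinctSteps = AllPairs λ (_ , l) (_ , l′) → ¬ Same l l′

  distinct-steps : ∀ h ws → Unique (h ∷ map proj₂ ws) → DistinctSteps (steps h ws)
  distinct-steps h [] _ = []
  distinct-steps h ((_ , w) ∷ ws) (h∉ ∷ uniq) =
    All.map (λ { (h≢i , h≢j) (inj₁ (h≡i , _)) → h≢i h≡i ; (h≢i , h≢j) (inj₂ (h≡j , _)) → h≢j h≡j })
      (steps-avoid w ws h∉) ∷ distinct-steps w ws uniq

  -- A third vertex is needed here: on two vertices the closing step is the first step reversed,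
  -- hence the same unoriented edge.
  distinct-closed-steps : ∀ c h w w′ ws → let ws⁺ = w ∷ w′ ∷ map proj₂ ws in Unique (h ∷ ws⁺) →
    ∀ {d d′} → DistinctSteps ((c , last h ws⁺ , h) ∷ steps h ((d , w) ∷ (d′ , w′) ∷ ws))
  distinct-closed-steps c h w w′ ws uniq@((h≢w ∷ h∉) ∷ (w∉ ∷ _)) {d} {d′} =
    ((λ { (inj₁ (_ , h≡w)) → h≢w h≡w ; (inj₂ (l≡w , _)) → last-fresh w′ (map proj₂ ws) w∉ (≡.sym l≡w) })
      ∷ All.map (λ { (h≢i , h≢j) (inj₁ (_ , h≡j)) → h≢j h≡j ; (h≢i , h≢j) (inj₂ (_ , h≡i)) → h≢i h≡i })
          (steps-avoid w ((d′ , w′) ∷ ws) (h≢w ∷ h∉)))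
    ∷ distinct-steps h ((d , w) ∷ (d′ , w′) ∷ ws) uniq

  linked-∷ʳ⁻ : ∀ {R : Fin n → Fin n → Set} h ws {v} → Linked R (h ∷ ws ∷ʳ v) → Linked R (h ∷ ws) × R (last h ws) v
  linked-∷ʳ⁻ h [] (r ∷ _) = [-] , r
  linked-∷ʳ⁻ h (w ∷ ws) (r ∷ rs) = let l , c = linked-∷ʳ⁻ w ws rs in r ∷ l , c

  linked⇒all-steps : ∀ {R : Fin n → Fin n → Set} h ws → Linked R (h ∷ map proj₂ ws) →
    All (λ (_ , i , j) → R i j) (steps h ws)
  linked⇒all-steps h [] _ = []
  linked⇒all-steps h ((_ , w) ∷ ws) (r ∷ rs) = r ∷ linked⇒all-steps w ws rs

module _ (A : ℚAlgebra) (comm : Commutative A) {n : ℕ} {y : Fin n → Fin n → ℚAlgebra.Carrier A}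
  (antisym : ∀ i j → ℚAlgebra._≈_ A (y j i) (ℚAlgebra.-_ A (y i j))) where
  open ℚAlgebra A hiding (zero)
  open SetoidReasoning setoid
  open AlgebraSolver A comm
  private
    P = ∏ A (uncurry y)

  same⇒multiple : ∀ {e l} → Same e l → ∃[ s ] uncurry y e ≈ s * uncurry y l
  same⇒multiple (inj₁ (≡.refl , ≡.refl)) = 1# , sym (*-identityˡ _)
  same⇒multiple (inj₂ (≡.refl , ≡.refl)) = - 1# , trans (antisym _ _) (sym (RingProperties.-1*x≈-x ring _))

  -- Each link is matched with a factor of `es`, equal up to sign, which is then removed. As the
  -- links are distinct as unoriented edges, the later ones stay covered.
  ∏-divisible : ∀ ls es → DistinctSteps ls → All (Covers es) ls → ∃[ r ] P es ≈ r * P ls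
  ∏-divisible [] es _ _ = P es , sym (*-identityʳ _)
  ∏-divisible (l ∷ ls) es (l∉ ∷ distinct) (cover ∷ covers) =
    let e , es′ , e~l , perm = extract {P = λ (_ , e) → Same e (proj₂ l)} {xs = es} cover
        s , e≈sl = same⇒multiple e~l
        r , es′≈ = ∏-divisible ls es′ distinct (All.zipWith {P = λ l′ → ¬ Same (proj₂ l) (proj₂ l′)} {Q = Covers es}
          (λ {l′} → restrict e~l perm {l′}) (l∉ , covers))
    in s * r , (begin
      P es                       ≈⟨ ∏-↭ A comm (uncurry y) perm ⟩
      uncurry y (proj₂ e) * P es′  ≈⟨ *-cong e≈sl es′≈ ⟩
      (s * uncurry y (proj₂ l)) * (r * P ls)
        ≈⟨ solve 4 (λ s l r p → (s :* l) :* (r :* p) := (s :* r) :* (l :* p)) refl s (uncurry y (proj₂ l)) r (P ls) ⟩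
      (s * r) * (uncurry y (proj₂ l) * P ls) ∎)
    where
    restrict : ∀ {e es′} → Same (proj₂ e) (proj₂ l) → es ↭ e ∷ es′ →
      ∀ {l′} → (¬ Same (proj₂ l) (proj₂ l′)) × Covers es l′ → Covers es′ l′
    restrict e~l perm (l≁l′ , c) with Any-resp-↭ perm c
    ... | here e~l′ = contradiction (same-unique e~l e~l′) l≁l′
    ... | there c′ = c′

  closed-walk≈0 : ∀ {l h ws} → y l h * y l h ≈ 0# →
    P (steps h ws) + y l h * ∂∏ A (uncurry y) (ones (steps h ws)) ≈ 0# → y l h * P (steps h ws) ≈ 0#
  closed-walk≈0 {l} {h} {ws} sq rel = begin
    u * p
      ≈⟨ solve 3 (λ u p r → u :* p := u :* (p :+ u :* r) :- (u :* u) :* r) refl u p r ⟩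
    u * (p + u * r) - (u * u) * r
      ≈⟨ +-cong (*-congˡ rel) (-‿cong (*-congʳ sq)) ⟩
    u * 0# - 0# * r
      ≈⟨ solve 2 (λ u r → u :* con 0ℚ :- con 0ℚ :* r := con 0ℚ) refl u r ⟩
    0# ∎
    where
    u = y l h
    p = P (steps h ws)
    r = ∂∏ A (uncurry y) (ones (steps h ws))

-- The Fomin-Kirillov algebra as the universal family

module _ (A : ℚAlgebra) {n : ℕ} (y : Fin n → Fin n → ℚAlgebra.Carrier A) where
  open ℚAlgebra A

  -- Setting y_ii = 0 extends the relations to coinciding indices: a degenerate triangle comes down
  -- to y_ik y_ki, which is minus a square.
  fromDistinct : (∀ i → y i i ≈ 0#) →
    (∀ i j → i ≢ j → y j i ≈ - y i j) →
    (∀ i j → i ≢ j → y i j * y i j ≈ 0#) →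
    (∀ i j k l → i ≢ j → k ≢ l → i ≢ k → i ≢ l → j ≢ k → j ≢ l → y i j * y k l ≈ y k l * y i j) →
    (∀ i j k → i ≢ j → j ≢ k → k ≢ i → y i j * y j k + y j k * y k i + y k i * y i j ≈ 0#) →
    FKFamily A y
  fromDistinct diagonal antisym′ square′ commute′ cyclic′ = record
    { diagonal = diagonal
    ; antisym = antisym
    ; nilpotent = nilpotent
    ; commute = λ {i} {j} {k} {l} → commute i j k l
    ; cyclic₃ = cyclic₃
    }
    where
    open SetoidReasoning setoid

    antisym : ∀ i j → y j i ≈ - y i j
    antisym i j with i ≟ j
    ... | yes ≡.refl = trans (diagonal i) (sym (trans (-‿cong (diagonal i)) (RingProperties.-0#≈0# ring)))
    ... | no i≢j = antisym′ i j i≢j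

    nilpotent : ∀ i j → y i j * y i j ≈ 0#
    nilpotent i j with i ≟ j
    ... | yes ≡.refl = trans (*-congʳ (diagonal i)) (zeroˡ _)
    ... | no i≢j = square′ i j i≢j

    commute : ∀ i j k l → i ≢ k → i ≢ l → j ≢ k → j ≢ l → y i j * y k l ≈ y k l * y i j
    commute i j k l with i ≟ j | k ≟ l
    ... | yes ≡.refl | _ = λ _ _ _ _ → trans (trans (*-congʳ (diagonal i)) (zeroˡ _))
                                          (sym (trans (*-congˡ (diagonal i)) (zeroʳ _)))
    ... | no _ | yes ≡.refl = λ _ _ _ _ → trans (trans (*-congˡ (diagonal k)) (zeroʳ _))
                                          (sym (trans (*-congʳ (diagonal k)) (zeroˡ _)))
    ... | no i≢j | no k≢l = commute′ i j k l i≢j k≢l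

    degenerate : ∀ i k → y i i * y i k + y i k * y k i + y k i * y i i ≈ 0#
    degenerate i k = begin
      y i i * y i k + y i k * y k i + y k i * y i i
        ≈⟨ +-cong (+-cong (trans (*-congʳ (diagonal i)) (zeroˡ _)) (*-congˡ (antisym i k)))
             (trans (*-congˡ (diagonal i)) (zeroʳ _)) ⟩
      0# + y i k * - y i k + 0#
        ≈⟨ trans (+-identityʳ _) (+-identityˡ _) ⟩
      y i k * - y i k
        ≈⟨ RingProperties.-‿distribʳ-* ring _ _ ⟨
      - (y i k * y i k)
        ≈⟨ trans (-‿cong (nilpotent i k)) (RingProperties.-0#≈0# ring) ⟩
      0# ∎

    cyclic₃ : ∀ i j k → y i j * y j k + y j k * y k i + y k i * y i j ≈ 0#
    cyclic₃ i j k with i ≟ j | j ≟ k | k ≟ i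
    ... | yes ≡.refl | _ | _ = degenerate i k
    ... | no _ | yes ≡.refl | _ = trans (trans (+-assoc _ _ _) (+-comm _ _)) (degenerate j i)
    ... | no _ | no _ | yes ≡.refl = trans (trans (+-comm _ _) (sym (+-assoc _ _ _))) (degenerate k j)
    ... | no i≢j | no j≢k | no k≢i = cyclic′ i j k i≢j j≢k k≢i

module _ {n : ℕ} where
  private
    FK = FominKirillov n
    F = Free (Pair n)
    module FK = ℚAlgebra FK
  open FK using (_≈_; _+_; _*_; -_; 0#)

  -- x_ij, extended by x_ii = 0.
  generator : Fin n → Fin n → Expr (Pair n)
  generator i j with i ≟ j
  ... | yes _ = con 0ℚ
  ... | no i≢j = gen (pair i j i≢j)

  generator-≢ : ∀ {i j} (i≢j : i ≢ j) → generator i j ≡ gen (pair i j i≢j)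
  generator-≢ {i} {j} i≢j with i ≟ j
  ... | yes i≡j = contradiction i≡j i≢j
  ... | no _ = ≡.refl

  generator-diagonal : ∀ i → generator i i ≡ con 0ℚ
  generator-diagonal i with i ≟ i
  ... | yes _ = ≡.refl
  ... | no i≢i = contradiction ≡.refl i≢i

  relator≈0 : ∀ {r} → FKRelator r → r ≈ 0#
  relator≈0 {r} p = ideal⇒≈0 F {FKRelator} {r} (base p)

  generator-fk : FKFamily FK generator
  generator-fk = fromDistinct FK generator
    (λ i → FK.reflexive (generator-diagonal i))
    (λ i j i≢j → ≡.subst₂ (λ p q → p ≈ - q) (≡.sym (generator-≢ (≡.≢-sym i≢j))) (≡.sym (generator-≢ i≢j))
      (base (antisymmetry j i (≡.≢-sym i≢j))))
    (λ i j i≢j → ≡.subst (λ p → p * p ≈ 0#) (≡.sym (generator-≢ i≢j)) (relator≈0 (square i j i≢j)))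
    (λ i j k l i≢j k≢l i≢k i≢l j≢k j≢l → ≡.subst₂ (λ p q → p * q ≈ q * p)
      (≡.sym (generator-≢ i≢j)) (≡.sym (generator-≢ k≢l)) (base (commuting i j k l i≢j k≢l i≢k i≢l j≢k j≢l)))
    (λ i j k i≢j j≢k k≢i → ≡.subst (λ p → p * generator j k + generator j k * generator k i + generator k i * p ≈ 0#)
      (≡.sym (generator-≢ i≢j)) (≡.subst₂ (λ q r → gen (pair i j i≢j) * q + q * r + r * gen (pair i j i≢j) ≈ 0#)
        (≡.sym (generator-≢ j≢k)) (≡.sym (generator-≢ k≢i)) (relator≈0 (triangle i j k i≢j j≢k k≢i))))

  module _ {A : ℚAlgebra} {y : Fin n → Fin n → ℚAlgebra.Carrier A} (fk : FKFamily A y) where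
    private
      module A = ℚAlgebra A
      module η = RingMorphisms.IsRingHomomorphism A.η-homo
    open FKFamily fk

    fk-eval : Expr (Pair n) → A.Carrier
    fk-eval = eval A λ (pair i j _) → y i j

    fk-eval-hom : IsHom FK A fk-eval
    fk-eval-hom = Hom.quotient-hom {F} {A} {fk-eval} (eval-hom A _) λ where
      (antisymmetry i j i≢j) → A.trans (A.+-congˡ (A.-‿cong (A.sym (antisym j i)))) (A.-‿inverseʳ (y i j))
      (square i j _) → nilpotent i j
      (commuting i j k l _ _ i≢k i≢l j≢k j≢l) → A.trans (A.+-congʳ (commute i≢k i≢l j≢k j≢l)) (A.-‿inverseʳ _)
      (triangle i j k _ _ _) → cyclic₃ i j k

    fk-eval-generator : ∀ i j → fk-eval (generator i j) A.≈ y i j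
    fk-eval-generator i j with i ≟ j
    ... | yes ≡.refl = A.trans η.0#-homo (A.sym (diagonal i))
    ... | no _ = A.refl

-- Orlik-Terao relations of a graph against relations in the Fomin-Kirillov algebra

module _ {n : ℕ} (G : Graph n) where
  open Graph G

  endpoints : Edge G → Fin n × Fin n
  endpoints (edge s t _) = s , t

  adjacent : (e : Edge G) → uncurry Adj (endpoints e)
  adjacent (edge s t st) = recompute (adj? s t) st

  endpoints-≢ : (e : Edge G) → uncurry _≢_ (endpoints e)
  endpoints-≢ e = adj⇒≢ G (adjacent e)

  private
    F = Free (Edge G)

  -- Only cycles of `Adj` are assumed to give relations. The elements to which this applies are
  -- extended by 0 to non-edges, so they need not satisfy the triangle relation and need not form an
  -- `FKFamily`.
  module OTRelations (A : ℚAlgebra) (comm : Commutative A) {y : Fin n → Fin n → ℚAlgebra.Carrier A}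
    (antisym : ∀ i j → ℚAlgebra._≈_ A (y j i) (ℚAlgebra.-_ A (y i j)))
    (nilpotent : ∀ i j → ℚAlgebra._≈_ A (ℚAlgebra._*_ A (y i j) (y i j)) (ℚAlgebra.0# A))
    (cyclic-rel : CycleSpace.CyclicRelation A comm y Adj) where
    open ℚAlgebra A hiding (zero)
    open SetoidReasoning setoid
    private
      ρ = uncurry y ∘ endpoints
      Y = uncurry y

    same-square : ∀ e e′ → SameEdge G e e′ → ρ e * ρ e′ ≈ 0#
    same-square (edge s t _) (edge _ _ _) (inj₁ (≡.refl , ≡.refl)) = nilpotent s t
    same-square (edge s t _) (edge _ _ _) (inj₂ (≡.refl , ≡.refl)) =
      trans (*-congˡ (antisym s t)) (trans (sym (RingProperties.-‿distribʳ-* ring _ _))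
        (trans (-‿cong (nilpotent s t)) (RingProperties.-0#≈0# ring)))

    private
      items : ∀ {k} → Vector (Edge G) k → List (ℚ × Fin n × Fin n)
      items e = tabulate λ p → 1ℚ , endpoints (e p)

    -- The monomial may have further factors and use either orientation of the edges of the cycle,
    -- so it is shown to be a multiple of the product around the cycle.
    cycle≈0 : ∀ {k} (e : Vector (Edge G) k) → ContainsCycle G (Support G e) → product (ρ ∘ e) ≈ 0#
    cycle≈0 e (v , [] , s≤s () , _)
    cycle≈0 e (v , w ∷ [] , s≤s (s≤s ()) , _)
    cycle≈0 {k} e (v , w ∷ w′ ∷ vs , _ , uniq , linked) =
      let r , eq = ∏-divisible A comm antisym links (items e) distinct covered in begin
        product (ρ ∘ e)      ≡⟨ product≡∏ A Y (λ _ → 1ℚ) (endpoints ∘ e) ⟩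
        ∏ A Y (items e)      ≈⟨ eq ⟩
        r * ∏ A Y links      ≈⟨ *-congˡ links≈0 ⟩
        r * 0#               ≈⟨ zeroʳ r ⟩
        0#                   ∎
      where
      ws ws′ : List (ℚ × Fin n)
      ws′ = map (1ℚ ,_) vs
      ws = (1ℚ , w) ∷ (1ℚ , w′) ∷ ws′
      vertices : map proj₂ ws′ ≡ vs
      vertices = ≡.trans (≡.sym (Listₚ.map-∘ vs)) (Listₚ.map-id vs)
      vertices⁺ : v ∷ w ∷ w′ ∷ map proj₂ ws′ ≡ v ∷ w ∷ w′ ∷ vs
      vertices⁺ = ≡.cong (λ l → v ∷ w ∷ w′ ∷ l) vertices
      l : Fin n
      l = last v (map proj₂ ws)
      links : List (ℚ × Fin n × Fin n)
      links = (1ℚ , l , v) ∷ steps v ws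
      uniq′ : Unique (v ∷ map proj₂ ws)
      uniq′ = ≡.subst Unique (≡.sym vertices⁺) uniq
      distinct : DistinctSteps links
      distinct = distinct-closed-steps 1ℚ v w w′ ws′ uniq′
      walked : Linked (Support G e) (v ∷ map proj₂ ws) × Support G e l v
      walked = linked-∷ʳ⁻ v (map proj₂ ws)
        (≡.subst (λ vs → Linked (Support G e) (v ∷ w ∷ w′ ∷ vs ∷ʳ v)) (≡.sym vertices) linked)
      cover : ∀ {i j} → Support G e i j → Covers (items e) (1ℚ , i , j)
      cover (p , joins) = Anyₚ.tabulate⁺ p (joined (e p) joins)
        where
        joined : ∀ e {i j} → Joins G e i j → Same (endpoints e) (i , j)
        joined (edge _ _ _) s = s
      covered : All (Covers (items e)) links
      covered = cover (proj₂ walked) ∷ All.map (λ s → cover s) (linked⇒all-steps v ws (proj₁ walked))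
      support-adj : ∀ {i j} → Support G e i j → Adj i j
      support-adj (p , joins) = go (e p) joins
        where
        go : ∀ e {i j} → Joins G e i j → Adj i j
        go e@(edge _ _ _) (inj₁ (≡.refl , ≡.refl)) = adjacent e
        go e@(edge _ _ _) (inj₂ (≡.refl , ≡.refl)) = symm (adjacent e)
      links≈0 : ∏ A Y links ≈ 0#
      links≈0 = closed-walk≈0 A comm antisym {l} {v} {ws} (nilpotent l v)
        (cyclic-rel v ws uniq′ (Linked.map support-adj (proj₁ walked)) (support-adj (proj₂ walked)))

    dependence≈0 : ∀ {k} (c : Vector ℚ (suc k)) (e : Vector (Edge G) (suc k)) → Dependence G c e → omitSum A ρ c e ≈ 0#
    dependence≈0 c e dep = begin
      omitSum A ρ c e
        ≈⟨ omitSum≈∂∏ A Y comm c (endpoints ∘ e) ⟩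
      ∂∏ A Y (tabulate λ p → c p , endpoints (e p))
        ≈⟨ CycleSpace.dependence A comm y Adj symm (adj⇒≢ G) (λ _ → antisym _ _) cyclic-rel
             (tabulate λ p → c p , endpoints (e p))
             (Allₚ.tabulate⁺ {f = λ p → c p , endpoints (e p)} λ p → adjacent (e p))
             (λ v → ≡.trans (≡.sym (sumℚ≡boundary id c (endpoints ∘ e) v)) (dep v)) ⟩
      0# ∎

    ot-relator≈0 : ∀ {r} → OTRelator G r → eval A ρ r ≈ 0#
    ot-relator≈0 (antisymmetry i j ij) = trans (+-congˡ (-‿cong (-‿cong (antisym i j))))
      (trans (+-congˡ (-‿cong (RingProperties.-‿involutive ring _))) (-‿inverseʳ _))
    ot-relator≈0 (repeated e (p , q , p≢q , same)) = trans (product-homo {F} {A} {eval A ρ} (eval-hom A ρ) (gen ∘ e))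
      (product-repeat≈0 A ρ comm e p≢q (same-square (e p) (e q) same))
    ot-relator≈0 (cyclic e cyc) = trans (product-homo {F} {A} {eval A ρ} (eval-hom A ρ) (gen ∘ e)) (cycle≈0 e cyc)
    ot-relator≈0 (dependent c e dep) = trans
      (omitSum-homo {F} {A} {eval A ρ} (eval-hom A ρ) (λ _ → refl) gen c e) (dependence≈0 c e dep)

  private
    toEdge : ∀ i j → Maybe.Maybe (Edge G)
    toEdge i j with adj? i j
    ... | yes ij = Maybe.just (edge i j ij)
    ... | no _ = Maybe.nothing

    toEdge-complete : ∀ e → MaybeAny.Any (e ≡_) (uncurry toEdge (endpoints e))
    toEdge-complete e@(edge s t _) with adj? s t
    ... | yes _ = MaybeAny.just ≡.refl
    ... | no ¬st = contradiction (adjacent e) ¬st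

  -- Each edge is listed in both orientations. In the multigraph these are two antiparallel edges,
  -- whose variables are tied together by a two-term dependence.
  edges : List (Edge G)
  edges = mapMaybe (uncurry toEdge) (cartesianProduct (allFin n) (allFin n))

  ∈-edges : ∀ e → e ∈ edges
  ∈-edges e@(edge s t _) = Anyₚ.mapMaybe⁺ (uncurry toEdge) _
    (Anyₚ.map⁺ (Any.map (λ { ≡.refl → toEdge-complete e }) (∈-cartesianProduct⁺ (∈-allFin s) (∈-allFin t))))

  index : Edge G → Fin (length edges)
  index e = Any.index (∈-edges e)

  lookup-index : ∀ e → lookup edges (index e) ≡ e
  lookup-index e = ≡.sym (Anyₚ.lookup-index (∈-edges e))

  embed : Expr (Edge G) → Expr (Pair n)
  embed = eval (FominKirillov n) (uncurry generator ∘ endpoints)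

  module FKRelations (A : ℚAlgebra) (comm : Commutative A)
    {f : Expr (Edge G) → ℚAlgebra.Carrier A} (f-hom : IsHom F A f)
    (f-η : ∀ q → ℚAlgebra._≈_ A (f (con q)) (ℚAlgebra.η A q))
    (f-relator : ∀ {r} → OTRelator G r → ℚAlgebra._≈_ A (f r) (ℚAlgebra.0# A)) where
    open ℚAlgebra A hiding (zero)
    private
      module f = RingMorphisms.IsRingHomomorphism f-hom
      ends : Fin (length edges) → Fin n × Fin n
      ends = endpoints ∘ lookup edges
      ρ : Fin (length edges) → Carrier
      ρ = f ∘ gen ∘ lookup edges

    same-edge : ∀ e → SameEdge G e e
    same-edge (edge _ _ _) = inj₁ (≡.refl , ≡.refl)

    ot-dependence : ∀ l → (∀ v → boundary ends l v ≡ 0ℚ) → ∂∏ A ρ l ≈ 0#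
    -- An Orlik-Terao dependence has at least one term; the empty list gives the empty sum.
    ot-dependence [] _ = refl
    ot-dependence l@(_ ∷ _) ∂≡0 = begin
      ∂∏ A ρ l
        ≡⟨ ≡.cong (∂∏ A ρ) (Listₚ.tabulate-lookup l) ⟨
      ∂∏ A ρ (tabulate λ p → c p , x p)
        ≈⟨ omitSum≈∂∏ A ρ comm c x ⟨
      omitSum A ρ c x
        ≈⟨ omitSum-homo {F} {A} {f} f-hom f-η gen c (lookup edges ∘ x) ⟨
      f (omitSum F gen c (lookup edges ∘ x))
        ≈⟨ f-relator (dependent c (lookup edges ∘ x) λ v → ≡.trans (edge-vectors v)
             (≡.trans (≡.cong (λ l → boundary ends l v) (Listₚ.tabulate-lookup l)) (∂≡0 v))) ⟩
      0# ∎
      where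
      open SetoidReasoning setoid
      c : Vector ℚ _
      c = proj₁ ∘ lookup l
      x : Vector (Fin (length edges)) _
      x = proj₂ ∘ lookup l
      edge-vectors = sumℚ≡boundary ends c x

    ot-model : IsModel ends A comm ρ
    ot-model = record
      { nilpotent = λ x → trans (*-congˡ (sym (trans (f.*-homo _ _) (trans (*-congˡ f.1#-homo) (*-identityʳ _)))))
          (trans (sym (f.*-homo _ _))
            (f-relator (repeated {k = 2} (λ _ → lookup edges x) (zero , suc zero , (λ ()) , same-edge (lookup edges x)))))
      ; loop≈0 = λ x loop → contradiction loop (endpoints-≢ (lookup edges x))
      ; dependence = λ l _ → ot-dependence l
      }

    -- Evaluation on a family factors through the Fomin-Kirillov algebra, where `h` is already zero.
    vanishing : ∀ h → ℚAlgebra._≈_ (FominKirillov n) (embed h) (con 0ℚ) →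
      FKVanishing ends (eval (Free (Fin (length edges))) (gen ∘ index) h)
    vanishing h h≈0 B B-comm {y} fk = begin
      eval B (uncurry y ∘ ends) (eval (Free _) (gen ∘ index) h)
        ≈⟨ eval-fusion {Free _} {B} (eval-hom B _) (λ _ → B.refl)
             (λ e → B.reflexive (≡.cong (uncurry y ∘ endpoints) (lookup-index e))) h ⟩
      eval B (uncurry y ∘ endpoints) h
        ≈⟨ eval-fusion {FominKirillov n} {B} (fk-eval-hom {A = B} fk) (λ _ → B.refl)
             (λ e → uncurry (fk-eval-generator {A = B} fk) (endpoints e)) h ⟨
      fk-eval {A = B} fk (embed h)
        ≈⟨ RingMorphisms.IsRingHomomorphism.⟦⟧-cong (fk-eval-hom {A = B} fk) {embed h} {con 0ℚ} h≈0 ⟩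
      B.η 0ℚ
        ≈⟨ RingMorphisms.IsRingHomomorphism.0#-homo B.η-homo ⟩
      B.0# ∎
      where
      module B = ℚAlgebra B
      open SetoidReasoning B.setoid

    -- By `completeness`, `h` written in the enumerated edges lies in the ideal of the multigraph
    -- relations, and these hold for the images of the edge variables under `f`.
    fk-relation : ∀ h → ℚAlgebra._≈_ (FominKirillov n) (embed h) (con 0ℚ) → f h ≈ 0#
    fk-relation h h≈0 = trans (trans (hom≈eval {A} {f = f} f-hom f-η h) 
        (sym (eval-fusion {Free (Fin (length edges))} {A} (eval-hom A ρ) (λ _ → refl) {ρ = gen ∘ index}
          (λ e → reflexive (≡.cong (f ∘ gen) (lookup-index e))) h)))
      (Hom.ideal-vanishes {Abelianization (Free (Fin (length edges)))} {A} (abelian-eval-hom A ρ comm)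
        (model-relator ends A comm ρ ot-model)
        (completeness (length edges) ends (eval (Free (Fin (length edges))) (gen ∘ index) h) (vanishing h h≈0)))

-- The commutative quotient of the subalgebra and the isomorphism

subalgebra-hom : {A : ℚAlgebra} {S : Pred (ℚAlgebra.Carrier A) 0ℓ} → IsHom (Subalgebra A S) A proj₁
subalgebra-hom {A} = record
  { isSemiringHomomorphism = record
    { isNearSemiringHomomorphism = record
      { +-isMonoidHomomorphism = record
        { isMagmaHomomorphism = record
          { isRelHomomorphism = record { cong = λ p → p }
          ; homo = λ _ _ → A.refl }
        ; ε-homo = A.refl }
      ; *-homo = λ _ _ → A.refl }
    ; 1#-homo = A.refl }
  ; -‿homo = λ _ → A.refl }
  where module A = ℚAlgebra A

module _ {A B : ℚAlgebra} {f : ℚAlgebra.Carrier A → ℚAlgebra.Carrier B} (f-hom : IsHom A B f) {n : ℕ}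
  {E : Fin n → Fin n → Set} {y : Fin n → Fin n → ℚAlgebra.Carrier A} {x : Fin n → Fin n → ℚAlgebra.Carrier B}
  (fy≈x : ∀ {i j} → E i j → ℚAlgebra._≈_ B (f (y i j)) (x i j)) where
  private
    module B = ℚAlgebra B
    module f = RingMorphisms.IsRingHomomorphism f-hom

  walk-homo : ∀ h ws → Linked E (h ∷ ws) → f (walk A y h ws) B.≈ walk B x h ws
  walk-homo h [] _ = f.1#-homo
  walk-homo h (w ∷ ws) (hw ∷ linked) = B.trans (f.*-homo _ _) (B.*-cong (fy≈x hw) (walk-homo w ws linked))

  cut-homo : ∀ {z z′} → f z B.≈ z′ → ∀ h ws → Linked E (h ∷ ws) → f (cut A y z h ws) B.≈ cut B x z′ h ws
  cut-homo fz≈z′ h [] _ = f.0#-homo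
  cut-homo fz≈z′ h (w ∷ ws) (hw ∷ linked) = B.trans (f.+-homo _ _) (B.+-cong
    (B.trans (f.*-homo _ _) (B.*-cong (walk-homo w ws linked) fz≈z′))
    (cut-homo (B.trans (f.*-homo _ _) (B.*-cong fz≈z′ (fy≈x hw))) w ws linked))

  closed-walk-homo : ∀ v w ws → Linked E (v ∷ w ∷ ws) → E (last w ws) v →
    f (ℚAlgebra._+_ A (walk A y v (w ∷ ws)) (cut A y (y (last w ws) v) v (w ∷ ws))) B.≈
    walk B x v (w ∷ ws) B.+ cut B x (x (last w ws) v) v (w ∷ ws)
  closed-walk-homo v w ws linked closing = B.trans (f.+-homo _ _)
    (B.+-cong (walk-homo v (w ∷ ws) linked) (cut-homo (fy≈x closing) v (w ∷ ws) linked))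

-- The proof of the cyclic relation passes through chords of the cycle, which
-- may be non-edges, so the relation is inherited from the ambient algebra B.
module EdgeFamily {A B : ℚAlgebra} {f : ℚAlgebra.Carrier A → ℚAlgebra.Carrier B} (f-hom : IsHom A B f)
  (f-reflects : ∀ {a b} → ℚAlgebra._≈_ B (f a) (f b) → ℚAlgebra._≈_ A a b)
  {n : ℕ} {x : Fin n → Fin n → ℚAlgebra.Carrier B} (fk : FKFamily B x)
  {E : Fin n → Fin n → Set} (E? : Decidable E) (E-sym : Symmetric E)
  {y : Fin n → Fin n → ℚAlgebra.Carrier A}
  (fy≈x : ∀ {i j} → E i j → ℚAlgebra._≈_ B (f (y i j)) (x i j))
  (y≈0 : ∀ {i j} → ¬ E i j → ℚAlgebra._≈_ A (y i j) (ℚAlgebra.0# A)) where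
  private
    module A = ℚAlgebra A
    module B = ℚAlgebra B
    module f = RingMorphisms.IsRingHomomorphism f-hom
    module fk = FKFamily fk

  edge-antisym : ∀ i j → y j i A.≈ A.- y i j
  edge-antisym i j with E? i j
  ... | yes ij = f-reflects (B.trans (fy≈x (E-sym ij)) (B.trans (fk.antisym i j)
                   (B.sym (B.trans (f.-‿homo _) (B.-‿cong (fy≈x ij))))))
  ... | no ¬ij = A.trans (y≈0 (¬ij ∘ E-sym))
                   (A.sym (A.trans (A.-‿cong (y≈0 ¬ij)) (RingProperties.-0#≈0# A.ring)))

  edge-nilpotent : ∀ i j → y i j A.* y i j A.≈ A.0#
  edge-nilpotent i j with E? i j
  ... | yes ij = f-reflects (B.trans (f.*-homo _ _) (B.trans (B.*-cong (fy≈x ij) (fy≈x ij))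
                   (B.trans (fk.nilpotent i j) (B.sym f.0#-homo))))
  ... | no ¬ij = A.trans (A.*-congʳ (y≈0 ¬ij)) (A.zeroˡ _)

  edge-cyclic : ∀ v w ws → Unique (v ∷ w ∷ ws) → Linked E (v ∷ w ∷ ws) → E (last w ws) v →
    walk A y v (w ∷ ws) A.+ cut A y (y (last w ws) v) v (w ∷ ws) A.≈ A.0#
  edge-cyclic v w ws uniq linked closing = f-reflects
    (B.trans (closed-walk-homo {A} {B} f-hom {E = E} {y} {x} fy≈x v w ws linked closing)
      (B.trans (cyclic-zero fk v w ws uniq) (B.sym f.0#-homo)))

abelianization-hom : {A B : ℚAlgebra} {f : ℚAlgebra.Carrier A → ℚAlgebra.Carrier B} →
  IsHom A B f → Commutative B → IsHom (Abelianization A) B f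
abelianization-hom {A} {B} {f} f-hom comm = Hom.quotient-hom {A} {B} {f} f-hom λ where
    (commutator a b) → begin
      f (a A.* b A.- b A.* a)    ≈⟨ trans (f.+-homo _ _) (+-congˡ (f.-‿homo _)) ⟩
      f (a A.* b) - f (b A.* a)  ≈⟨ +-cong (f.*-homo a b) (-‿cong (trans (f.*-homo b a) (comm (f b) (f a)))) ⟩
      f a * f b - f a * f b      ≈⟨ -‿inverseʳ _ ⟩
      0#                         ∎
  where
  module A = ℚAlgebra A
  module f = RingMorphisms.IsRingHomomorphism f-hom
  open ℚAlgebra B
  open SetoidReasoning setoid

-- The evaluation takes place in the underlying carrier, so f need not
-- descend to the abelianization.
eval-fusion-ab : {A B : ℚAlgebra} {f : ℚAlgebra.Carrier A → ℚAlgebra.Carrier B} → IsHom A B f →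
  (∀ q → ℚAlgebra._≈_ B (f (ℚAlgebra.η A q)) (ℚAlgebra.η B q)) →
  {X : Set} {ρ : X → ℚAlgebra.Carrier A} {τ : X → ℚAlgebra.Carrier B} → (∀ x → ℚAlgebra._≈_ B (f (ρ x)) (τ x)) →
  ∀ a → ℚAlgebra._≈_ B (f (eval (Abelianization A) ρ a)) (eval B τ a)
eval-fusion-ab {A} {B} {f} f-hom f-η {ρ = ρ} {τ} fρ≈τ = go
  where
  open ℚAlgebra B
  module f = RingMorphisms.IsRingHomomorphism f-hom
  go : ∀ a → f (eval (Abelianization A) ρ a) ≈ eval B τ a
  go (gen x) = fρ≈τ x
  go (con q) = f-η q
  go (a ⊕ b) = trans (f.+-homo _ _) (+-cong (go a) (go b))
  go (a ⊗ b) = trans (f.*-homo _ _) (*-cong (go a) (go b))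
  go (⊝ a) = trans (f.-‿homo _) (-‿cong (go a))

eval-ab-section : {A B : ℚAlgebra} {f : ℚAlgebra.Carrier A → ℚAlgebra.Carrier B} → IsHom A B f →
  (∀ q → ℚAlgebra._≈_ B (f (ℚAlgebra.η A q)) (ℚAlgebra.η B q)) →
  {X : Set} {f′ : Expr X → ℚAlgebra.Carrier B} → IsHom (Free X) B f′ →
  (∀ q → ℚAlgebra._≈_ B (f′ (con q)) (ℚAlgebra.η B q)) →
  {ρ : X → ℚAlgebra.Carrier A} → (∀ x → ℚAlgebra._≈_ B (f (ρ x)) (f′ (gen x))) →
  ∀ a → ℚAlgebra._≈_ B (f (eval (Abelianization A) ρ a)) (f′ a)
eval-ab-section {A} {B} {f} f-hom f-η {f′ = f′} f′-hom f′-η {ρ} fρ≈f′ a = trans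
    (eval-fusion-ab {A} {B} {f} f-hom f-η {ρ = ρ} {f′ ∘ gen} fρ≈f′ a)
    (sym (hom≈eval {B} {f = f′} f′-hom f′-η a))
  where open ℚAlgebra B

module AbelianizedEdges {n : ℕ} (G : Graph n) (A : ℚAlgebra) (y : Fin n → Fin n → ℚAlgebra.Carrier A) where
  open Graph G
  private
    module A = ℚAlgebra A
    A^ab = Abelianization A
    F = Free (Edge G)
    module A^ab = ℚAlgebra A^ab

    A^ab-comm : Commutative A^ab
    A^ab-comm = abelianization-commutative A

    y′ : Fin n → Fin n → A^ab.Carrier
    y′ = y

  fromOT : Expr (Edge G) → A^ab.Carrier
  fromOT = eval A^ab (uncurry y′ ∘ endpoints G)

  module _
    (antisym : ∀ i j → y j i A.≈ A.- y i j)
    (nilpotent : ∀ i j → y i j A.* y i j A.≈ A.0#)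
    (cyclic-rel : ∀ v w ws → Unique (v ∷ w ∷ ws) → Linked Adj (v ∷ w ∷ ws) → Adj (last w ws) v →
      walk A y v (w ∷ ws) A.+ cut A y (y (last w ws) v) v (w ∷ ws) A.≈ A.0#) where

    private
      q : IsHom A A^ab id
      q = into-quotient {A} {A} (id-hom {A})

      cyclic-ab : ∀ v w ws → Unique (v ∷ w ∷ ws) → Linked Adj (v ∷ w ∷ ws) → Adj (last w ws) v →
        walk A^ab y′ v (w ∷ ws) A^ab.+ cut A^ab y′ (y′ (last w ws) v) v (w ∷ ws) A^ab.≈ A^ab.0#
      cyclic-ab v w ws uniq linked closing = A^ab.trans
        (A^ab.sym (closed-walk-homo {A} {A^ab} {id} q {E = Adj} {y} {y′} (λ _ → A^ab.refl) v w ws linked closing))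
        (≈⇒≈ᵢ A (cyclic-rel v w ws uniq linked closing))

    -- The cyclic relation is supplied as an identity of `A`, before commutators are divided out.
    -- Its image in `A^ab` is what the commutative argument for dependences requires.
    fromOT-hom : IsHom (OrlikTerao G) A^ab fromOT
    fromOT-hom = Hom.quotient-hom {Abelianization F} {A^ab} (abelian-eval-hom A^ab _ A^ab-comm)
      (OTRelations.ot-relator≈0 G A^ab A^ab-comm {y′}
        (λ i j → ≈⇒≈ᵢ A (antisym i j)) (λ i j → ≈⇒≈ᵢ A (nilpotent i j))
        (cut⇒CyclicRelation A^ab A^ab-comm y′ Adj (adj⇒≢ G) cyclic-ab))

-- The map `g` respects equality only up to commutators, so although `g (f a)` equals `a` in `A`
-- itself, injectivity of `f` follows only modulo commutators.
abelianization-isomorphism : (A B : ℚAlgebra) → Commutative B →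
  {f : ℚAlgebra.Carrier A → ℚAlgebra.Carrier B} → IsHom A B f →
  (∀ q → ℚAlgebra._≈_ B (f (ℚAlgebra.η A q)) (ℚAlgebra.η B q)) →
  (g : ℚAlgebra.Carrier B → ℚAlgebra.Carrier A) → IsHom B (Abelianization A) g →
  (∀ a → ℚAlgebra._≈_ A (g (f a)) a) → (∀ b → ℚAlgebra._≈_ B (f (g b)) b) →
  IsℚAlgebraIsomorphism (Abelianization A) B f
abelianization-isomorphism A B comm {f} f-hom f-η g g-hom gf≈id fg≈id = record
  { isRingIsomorphism = record
    { isRingMonomorphism = record
      { isRingHomomorphism = f-ab
      ; injective = λ {a} {b} fa≈fb → A^ab.trans (A^ab.sym (≈⇒≈ᵢ A (gf≈id a)))
          (A^ab.trans (g.⟦⟧-cong fa≈fb) (≈⇒≈ᵢ A (gf≈id b))) }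
    ; surjective = λ b → g b , λ z≈gb → B.trans (f.⟦⟧-cong z≈gb) (fg≈id b) }
  ; η-preserving = f-η }
  where
  module A^ab = ℚAlgebra (Abelianization A)
  module B = ℚAlgebra B
  f-ab : IsHom (Abelianization A) B f
  f-ab = abelianization-hom {A} {B} f-hom comm
  module f = RingMorphisms.IsRingHomomorphism f-ab
  module g = RingMorphisms.IsRingHomomorphism g-hom

module _ {n : ℕ} (G : Graph n) where
  open Graph G
  private
    FK = FominKirillov n
    FKₛ = FKSubalgebra G
    FKₐ = FKAb G
    F = Free (Edge G)
    OT = OrlikTerao G
    module FK = ℚAlgebra FK
    module FKₛ = ℚAlgebra FKₛ
    module FKₐ = ℚAlgebra FKₐ
    module OT = ℚAlgebra OT

    OT-comm : Commutative OT
    OT-comm = presented-commutative {Edge G} {OTRelator G}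

    -- x_ij as an element of the subalgebra, extended by 0 to non-edges.
    y : Fin n → Fin n → FKₛ.Carrier
    y i j with adj? i j
    ... | yes ij = fk G i j ij
    ... | no _ = FKₛ.0#

    y-edge : ∀ {i j} → Adj i j → proj₁ (y i j) ≡ generator i j
    y-edge {i} {j} ij with adj? i j
    ... | yes ij′ = ≡.sym (generator-≢ (adj⇒≢ G ij′))
    ... | no ¬ij = contradiction ij ¬ij

    y-nonedge : ∀ {i j} → ¬ Adj i j → y i j ≡ FKₛ.0#
    y-nonedge {i} {j} ¬ij with adj? i j
    ... | yes ij = contradiction ij ¬ij
    ... | no _ = ≡.refl

    open EdgeFamily {FKₛ} {FK} {proj₁} (subalgebra-hom {FK} {EdgeGenerator G}) (λ p → p)
      {x = generator} generator-fk adj? symm {y} (λ ij → FK.reflexive (y-edge ij))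
      (λ {i} {j} ¬ij → FK.reflexive (≡.cong proj₁ (y-nonedge {i} {j} ¬ij)))

    inverse : OT.Carrier → FKₛ.Carrier
    inverse = AbelianizedEdges.fromOT G FKₛ y

    inverse-hom : IsHom OT FKₐ inverse
    inverse-hom = AbelianizedEdges.fromOT-hom G FKₛ y edge-antisym edge-nilpotent edge-cyclic

    embed≈0⇒≈0 : ∀ h → embed G h FK.≈ con 0ℚ → h OT.≈ OT.0#
    embed≈0⇒≈0 = FKRelations.fk-relation G OT OT-comm {id}
      (presentation-hom {Edge G} {OTRelator G}) (λ c → OT.refl {con c}) presentation-relator

    -- Reads an expression in the edge variables off the derivation that `a` lies in the subalgebra.
    -- It depends on the derivation; `φ-cong` shows that its class does not.
    express : ∀ {a} → Generated FK (EdgeGenerator G) a → Expr (Edge G)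
    express (resp _ p) = express p
    express (base (edgeGenerator i j ij)) = gen (edge i j ij)
    express (scal c) = con c
    express (add p p′) = express p ⊕ express p′
    express (mul p p′) = express p ⊗ express p′

    embed-express : ∀ {a} (p : Generated FK (EdgeGenerator G) a) → embed G (express p) FK.≈ a
    embed-express (resp {a} {b} a≈b p) = FK.trans {embed G (express p)} {a} {b} (embed-express p) a≈b
    embed-express (base (edgeGenerator i j ij)) = FK.reflexive (generator-≢ (adj⇒≢ G ij))
    embed-express (scal c) = FK.refl {con c}
    embed-express (add {a} {b} p p′) =
      FK.+-cong {embed G (express p)} {a} {embed G (express p′)} {b} (embed-express p) (embed-express p′)
    embed-express (mul {a} {b} p p′) =
      FK.*-cong {embed G (express p)} {a} {embed G (express p′)} {b} (embed-express p) (embed-express p′)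

    φ : FKₛ.Carrier → OT.Carrier
    φ (_ , p) = express p

    -- The difference of the two chosen expressions becomes zero in the Fomin-Kirillov algebra,
    -- hence is a consequence of the Orlik-Terao relations.
    φ-cong : ∀ {z z′} → z FKₛ.≈ z′ → φ z OT.≈ φ z′
    φ-cong {a , p} {b , p′} a≈b = RingProperties.x∙y⁻¹≈ε⇒x≈y OT.ring (express p) (express p′)
      (embed≈0⇒≈0 (express p ⊕ ⊝ express p′)
        (FK.trans {embed G (express p) FK.- embed G (express p′)} {a FK.- b} {FK.0#}
          (FK.+-cong {embed G (express p)} {a} {FK.- embed G (express p′)} {FK.- b} (embed-express p)
            (FK.-‿cong {embed G (express p′)} {b} (embed-express p′)))
          (FK.trans {a FK.- b} {b FK.- b} {FK.0#} (FK.+-congʳ {FK.- b} {a} {b} a≈b) (FK.-‿inverseʳ b))))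

    φ-hom-sub : IsHom FKₛ OT φ
    φ-hom-sub = record
      { isSemiringHomomorphism = record
        { isNearSemiringHomomorphism = record
          { +-isMonoidHomomorphism = record
            { isMagmaHomomorphism = record
              { isRelHomomorphism = record { cong = λ {z} {z′} → φ-cong {z} {z′} }
              ; homo = λ z z′ → OT.refl {φ z ⊕ φ z′} }
            ; ε-homo = OT.refl {con 0ℚ} }
          ; *-homo = λ z z′ → OT.refl {φ z ⊗ φ z′} }
        ; 1#-homo = OT.refl {con 1ℚ} }
      ; -‿homo = φ-neg }
      where
      -- A negative belongs to the subalgebra by a derivation that multiplies by the scalar -1, and
      -- `express` reproduces that product.
      φ-neg : ∀ z → con (ℚ.- 1ℚ) ⊗ φ z OT.≈ ⊝ φ z
      φ-neg z = OT.trans {con (ℚ.- 1ℚ) ⊗ φ z} {⊝ con 1ℚ ⊗ φ z} {⊝ φ z}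
        (OT.*-congʳ {φ z} {con (ℚ.- 1ℚ)} {⊝ con 1ℚ} (RingMorphisms.IsRingHomomorphism.-‿homo OT.η-homo 1ℚ))
        (RingProperties.-1*x≈-x OT.ring (φ z))

    -- This holds before abelianization: `express` keeps the order of the factors, and `inverse`
    -- evaluates the same noncommutative expression back in the subalgebra.
    inverse-φ : ∀ z → inverse (φ z) FKₛ.≈ z
    inverse-φ (a , p) = FK.trans {proj₁ (inverse (express p))} {embed G (express p)} {a}
      (eval-fusion-ab {FKₛ} {FK} {proj₁} (subalgebra-hom {FK} {EdgeGenerator G}) (λ c → FK.refl {con c})
        {ρ = uncurry y ∘ endpoints G} {uncurry generator ∘ endpoints G}
        (λ e → FK.reflexive (y-edge (adjacent G e))) (express p))
      (embed-express p)

    φ-edge : ∀ i j (ij : Adj i j) → φ (y i j) ≡ gen (edge i j ij)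
    φ-edge i j ij with adj? i j
    ... | yes _ = ≡.refl
    ... | no ¬ij = contradiction ij ¬ij

    φ-inverse : ∀ h → φ (inverse h) OT.≈ h
    φ-inverse = eval-ab-section {FKₛ} {OT} {φ} φ-hom-sub (λ c → OT.refl {con c}) {f′ = id}
      (presentation-hom {Edge G} {OTRelator G}) (λ c → OT.refl {con c})
      {ρ = uncurry y ∘ endpoints G} (λ e@(edge i j _) → OT.reflexive (φ-edge i j (adjacent G e)))

    φ-isomorphism : IsℚAlgebraIsomorphism FKₐ OT φ
    φ-isomorphism = record
      { isRingIsomorphism = IsℚAlgebraIsomorphism.isRingIsomorphism
          (abelianization-isomorphism FKₛ OT OT-comm {φ} φ-hom-sub (λ c → OT.refl {con c})
            inverse inverse-hom inverse-φ φ-inverse)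
      ; η-preserving = λ c → OT.refl {con c} }

    φ-generator : ∀ i j (ij : Adj i j) → φ (fk G i j ij) OT.≈ ot G i j ij
    φ-generator i j ij = OT.refl {gen (edge i j ij)}

  FKAb≅OrlikTerao :
    Σ[ φ ∈ (FKₐ.Carrier → OT.Carrier) ]
      IsℚAlgebraIsomorphism FKₐ OT φ × (∀ i j (ij : Adj i j) → φ (fk G i j ij) OT.≈ ot G i j ij)
  FKAb≅OrlikTerao = φ , φ-isomorphism , φ-generator

theorem2p8 : (n : ℕ) (G : Graph n) →
    Σ[ φ ∈ (ℚAlgebra.Carrier (FKAb G) → ℚAlgebra.Carrier (OrlikTerao G)) ]
    IsℚAlgebraIsomorphism (FKAb G) (OrlikTerao G) φ
    × (∀ i j (ij : Graph.Adj G i j) →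
    ℚAlgebra._≈_ (OrlikTerao G) (φ (fk G i j ij)) (ot G i j ij))
theorem2p8 n G = FKAb≅OrlikTerao G
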